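{- Let $D$ be a finite set with $|D|\ge 2$ and let $W$ be a weighted clone on $D$ that is a rigid core and contains a positive weighting. Then $W$ contains a weighting $\omega$ with $\mathrm{supp}(\omega)\neq\emptyset$ such that one of the following holds: 1. $\omega$ is binary and $\mathrm{supp}(\omega)$ is a set of binary idempotent operations that are not projections; or 2. $\omega$ is ternary and one of the following holds: (a) $\mathrm{supp}(\omega)$ is a set of majority operations; or (b) $\mathrm{supp}(\omega)$ is a set of minority operations; or (c) $\mathrm{supp}(\omega)$ consists of a set of majority operations with total weight $2$ and a set of minority operations with total weight $1$ (that is, every operation in $\mathrm{supp}(\omega)$ is a majority or a minority operation, the sum of $\omega(f)$ over the majority operations $f\in\mathrm{supp}(\omega)$ is $2$, and the sum of $\omega(f)$ over the minority operations $f\in\mathrm{supp}(\omega)$ is $1$); or 3. for some $k\ge 3$, $\omega$ is $k$-ary and $\mathrm{supp}(\omega)$ is a set of $k$-ary semiprojections.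
   Context: A $k$-ary operation on $D$ is a map $f:D^k\to D$. The $k$-ary projections are $e^{(k)}_i(x_1,\dots,x_k)=x_i$, $1\le i\le k$. For a $k$-ary $f$ and $\ell$-ary $g_1,\dots,g_k$, the superposition $f[g_1,\dots,g_k]$ is the $\ell$-ary operation $(x_1,\dots,x_\ell)\mapsto f(g_1(x_1,\dots,x_\ell),\dots,g_k(x_1,\dots,x_\ell))$. A clone $C$ on $D$ is a set of operations on $D$ containing all projections and closed under superposition; $C^{(k)}$ denotes its $k$-ary operations. A $k$-ary weighting of a clone $C$ is a function $\omega:C^{(k)}\to\mathbb{Q}$ such that $\omega(f)<0$ only if $f$ is a projection, and $\sum_{f\in C^{(k)}}\omega(f)=0$. Its support is $\mathrm{supp}(\omega)=\{f\in C^{(k)}\mid\omega(f)>0\}$. A weighting is positive if it assigns positive weight to at least one operation that is not a projection. For a $k$-ary weighting $\omega$ of $C$ and $g_1,\dots,g_k\in C^{(\ell)}$, the superposition $\omega[g_1,\dots,g_k]:C^{(\ell)}\to\mathbb{Q}$ is defined by $\omega[g_1,\dots,g_k](f')=\sum_{\{f\in C^{(k)}\mid f[g_1,\dots,g_k]=f'\}}\omega(f)$; it is called proper if it is again a weighting (negative values occur only on projections). A weighted clone $W$ on $D$ is a non-empty set of weightings of some fixed clone $C$ on $D$, called the support clone of $W$, that is closed under non-negative (rational) scaling, addition of weightings of equal arity, and proper superposition with operations from $C$. $W$ is a rigid core if the only unary operation in its support clone is the unary projection $e^{(1)}_1$. An operation $f$ is idempotent if $f(x,\dots,x)=x$ for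 all $x\in D$. A ternary operation $f$ is a majority operation if $f(x,x,y)=f(x,y,x)=f(y,x,x)=x$ for all $x,y\in D$, and a minority operation if $f(x,x,y)=f(x,y,x)=f(y,x,x)=y$ for all $x,y\in D$. For $k\ge 3$, a $k$-ary operation $f$ is a semiprojection if it is not a projection but there is an index $1\le i\le k$ such that $f(x_1,\dots,x_k)=x_i$ whenever $x_1,\dots,x_k\in D$ are not pairwise distinct. -}

module Defs where

open import Level using (Level; _⊔_) renaming (suc to lsuc)
open import Data.Bool.Base using (if_then_else_)
open import Data.Fin.Base using (Fin; zero; suc; combine; finToFun; funToFin)
open import Data.Fin.Properties as Fin using (finToFun-funToFin; funToFin-finToFin)
open import Data.Integer.Base as ℤ using ()
open import Data.Nat.Base as ℕ using (ℕ; zero; suc)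
open import Data.Product.Base using (∃; _×_)
open import Data.Rational.Base using (ℚ; 0ℚ; _/_; _+_; _*_; _≤_; _<_)
open import Data.Rational.Properties using (+-0-commutativeMonoid; _<?_)
open import Data.Sum.Base using (_⊎_)
open import Data.Vec.Base using (Vec; []; _∷_; lookup; tabulate; replicate)
open import Data.Vec.Properties using (tabulate-cong; tabulate∘lookup; lookup∘tabulate)
open import Data.Vec.Relation.Unary.Unique.Propositional using (Unique)
open import Function.Base using (_∘_)
open import Function.Bundles using (_↔_; module Inverse)
open import Relation.Binary.Definitions using (DecidableEquality)
open import Relation.Binary.PropositionalEquality
  using (_≡_; _≗_; refl; sym; trans; cong; cong₂; subst)
open import Relation.Nullary.Decidable using (Dec; does; map′; _×-dec_)
open import Relation.Nullary.Negation using (¬_)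
open import Relation.Unary using (Pred; Decidable)

open import Algebra.Properties.CommutativeMonoid.Sum +-0-commutativeMonoid using (sum)

private
  variable
    a c w p : Level
    k ℓ : ℕ

-- Functions are not extensional here, so equality of operations is _≗_.
Op : Set a → ℕ → Set a
Op D k = Vec D k → D

module _ {D : Set a} where

  proj : Fin k → Op D k
  proj i xs = lookup xs i

  IsProjection : Op D k → Set a
  IsProjection f = ∃ λ i → f ≗ proj i

  infix 9 _⟦_⟧
  _⟦_⟧ : Op D k → (Fin k → Op D ℓ) → Op D ℓ
  (f ⟦ gs ⟧) xs = f (tabulate λ i → gs i xs)

  IsIdempotent : Op D k → Set a
  IsIdempotent {k} f = ∀ x → f (replicate k x) ≡ x

  IsMajority : Op D 3 → Set a
  IsMajority f = ∀ x y →
    f (x ∷ x ∷ y ∷ []) ≡ x × f (x ∷ y ∷ x ∷ []) ≡ x × f (y ∷ x ∷ x ∷ []) ≡ x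

  IsMinority : Op D 3 → Set a
  IsMinority f = ∀ x y →
    f (x ∷ x ∷ y ∷ []) ≡ y × f (x ∷ y ∷ x ∷ []) ≡ y × f (y ∷ x ∷ x ∷ []) ≡ y

  IsSemiprojection : Op D k → Set a
  IsSemiprojection f =
    ¬ IsProjection f × ∃ λ i → ∀ xs → ¬ Unique xs → f xs ≡ lookup xs i

record Clone (D : Set a) (c : Level) : Set (a ⊔ lsuc c) where
  infix 4 _∈C
  field
    _∈C           : Op D k → Set c
    ∈C-resp-≗     : {f g : Op D k} → f ≗ g → f ∈C → g ∈C
    proj-∈C       : (i : Fin k) → proj i ∈C
    superpose-∈C  : {f : Op D k} {gs : Fin k → Op D ℓ} →
                    f ∈C → (∀ i → gs i ∈C) → f ⟦ gs ⟧ ∈C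

module FiniteSet {D : Set a} {n : ℕ} (D↔Fin : D ↔ Fin n) where

  open Inverse D↔Fin using (to; from; strictlyInverseˡ; strictlyInverseʳ)

  _≟_ : DecidableEquality D
  x ≟ y = map′ (λ e → trans (sym (strictlyInverseʳ x))
                        (trans (cong from e) (strictlyInverseʳ y)))
               (cong to)
               (to x Fin.≟ to y)

  all? : {P : Pred D p} → Decidable P → Dec (∀ x → P x)
  all? {P = P} P? = map′ (λ h x → subst P (strictlyInverseʳ x) (h (to x)))
                         (λ h i → h (from i))
                         (Fin.all? (P? ∘ from))

  allVec? : ∀ k {P : Pred (Vec D k) p} → Decidable P → Dec (∀ xs → P xs)
  allVec? zero    P? = map′ (λ { h [] → h }) (λ h → h []) (P? [])
  allVec? (suc k) P? = map′ (λ { h (x ∷ xs) → h x xs }) (λ h x xs → h (x ∷ xs))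
                            (all? λ x → allVec? k λ xs → P? (x ∷ xs))

  _≗?_ : (f g : Op D k) → Dec (f ≗ g)
  _≗?_ {k} f g = allVec? k λ xs → f xs ≟ g xs

  isMajority? : Decidable (IsMajority {D = D})
  isMajority? f = all? λ x → all? λ y →
    (f (x ∷ x ∷ y ∷ []) ≟ x) ×-dec (f (x ∷ y ∷ x ∷ []) ≟ x) ×-dec (f (y ∷ x ∷ x ∷ []) ≟ x)

  isMinority? : Decidable (IsMinority {D = D})
  isMinority? f = all? λ x → all? λ y →
    (f (x ∷ x ∷ y ∷ []) ≟ y) ×-dec (f (x ∷ y ∷ x ∷ []) ≟ y) ×-dec (f (y ∷ x ∷ x ∷ []) ≟ y)

  -- The k-ary operations are numbered by Fin (n ^ (n ^ k)): a tuple is a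
  -- number below n ^ k, and an operation is its table of values.

  tupleCode : Vec D k → Fin (n ℕ.^ k)
  tupleCode xs = funToFin (to ∘ lookup xs)

  tuple : Fin (n ℕ.^ k) → Vec D k
  tuple j = tabulate (from ∘ finToFun j)

  opCode : Op D k → Fin (n ℕ.^ (n ℕ.^ k))
  opCode f = funToFin (to ∘ f ∘ tuple)

  op : Fin (n ℕ.^ (n ℕ.^ k)) → Op D k
  op i xs = from (finToFun i (tupleCode xs))

  private
    funToFin-cong : ∀ {m} {f g : Fin k → Fin m} → f ≗ g → funToFin f ≡ funToFin g
    funToFin-cong {zero}  f≗g = refl
    funToFin-cong {suc k} f≗g =
      cong₂ combine (f≗g zero) (funToFin-cong (f≗g ∘ suc))

  tuple-tupleCode : (xs : Vec D k) → tuple (tupleCode xs) ≡ xs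
  tuple-tupleCode xs = trans
    (tabulate-cong λ i → trans (cong from (finToFun-funToFin (to ∘ lookup xs) i))
                               (strictlyInverseʳ (lookup xs i)))
    (tabulate∘lookup xs)

  op-opCode : (f : Op D k) → op (opCode f) ≗ f
  op-opCode f xs = trans
    (cong from (finToFun-funToFin (to ∘ f ∘ tuple) (tupleCode xs)))
    (trans (strictlyInverseʳ _) (cong f (tuple-tupleCode xs)))

  tupleCode-tuple : (j : Fin (n ℕ.^ k)) → tupleCode {k} (tuple j) ≡ j
  tupleCode-tuple {k} j = trans
    (funToFin-cong {k} λ i → trans (cong to (lookup∘tabulate (from ∘ finToFun j) i))
                               (strictlyInverseˡ _))
    (funToFin-finToFin {k} {n} j)

  opCode-op : (i : Fin (n ℕ.^ (n ℕ.^ k))) → opCode {k} (op i) ≡ i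
  opCode-op {k} i = trans
    (funToFin-cong λ j → trans (strictlyInverseˡ _)
                               (cong (finToFun i) (tupleCode-tuple {k} j)))
    (funToFin-finToFin {n ℕ.^ k} {n} i)

  ∑Op : (Op D k → ℚ) → ℚ
  ∑Op {k} ω = sum {n ℕ.^ (n ℕ.^ k)} (ω ∘ op)

  ∑Op[_] : {P : Pred (Op D k) p} → Decidable P → (Op D k → ℚ) → ℚ
  ∑Op[ P? ] ω = ∑Op λ f → if does (P? f) then ω f else 0ℚ

-- A function C⁽ᵏ⁾ → ℚ is represented by its extension by zero to all k-ary
-- operations; see IsWeighting.vanishes.
Weight : Set a → ℕ → Set a
Weight D k = Op D k → ℚ

module _ {D : Set a} where

  infix 4 _∈supp_
  _∈supp_ : Op D k → Weight D k → Set
  f ∈supp ω = 0ℚ < ω f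

  IsPositive : Weight D k → Set a
  IsPositive ω = ∃ λ f → ¬ IsProjection f × f ∈supp ω

module _ {D : Set a} {n : ℕ} (D↔Fin : D ↔ Fin n) where

  open FiniteSet D↔Fin

  record IsWeighting (C : Clone D c) (ω : Weight D k) : Set (a ⊔ c) where
    open Clone C
    field
      resp-≗    : ∀ {f g} → f ≗ g → ω f ≡ ω g
      -- Contrapositive of "ω f ≡ 0ℚ for f outside C", so that membership
      -- in C need not be decidable.
      vanishes  : ∀ f → ¬ (ω f ≡ 0ℚ) → f ∈C
      negative  : ∀ f → ω f < 0ℚ → IsProjection f
      sum≡0     : ∑Op ω ≡ 0ℚ

  superposeWeight : Weight D k → (Fin k → Op D ℓ) → Weight D ℓ
  superposeWeight ω gs f′ = ∑Op[ (λ f → (f ⟦ gs ⟧) ≗? f′) ] ω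

  record WeightedClone (c w : Level) : Set (a ⊔ lsuc (c ⊔ w)) where
    field
      supportClone : Clone D c
    open Clone supportClone public
    infix 4 _∈W
    field
      _∈W           : Weight D k → Set w
      ∈W-resp-≗     : {ω ω′ : Weight D k} → ω ≗ ω′ → ω ∈W → ω′ ∈W
      isWeighting   : {ω : Weight D k} → ω ∈W → IsWeighting supportClone ω
      nonEmpty      : ∃ λ k → ∃ λ (ω : Weight D k) → ω ∈W
      scale-∈W      : {ω : Weight D k} (q : ℚ) → 0ℚ ≤ q →
                      ω ∈W → (λ f → q * ω f) ∈W
      +-∈W          : {ω ω′ : Weight D k} →
                      ω ∈W → ω′ ∈W → (λ f → ω f + ω′ f) ∈W
      -- The last hypothesis says that the superposition is proper.
      superpose-∈W  : {ω : Weight D k} {gs : Fin k → Op D ℓ} →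
                      ω ∈W → (∀ i → gs i ∈C) →
                      IsWeighting supportClone (superposeWeight ω gs) →
                      superposeWeight ω gs ∈W

  IsRigidCore : WeightedClone c w → Set (a ⊔ c)
  IsRigidCore W = (f : Op D 1) → f ∈C → f ≗ proj zero
    where open WeightedClone W

  majorityWeight : Weight D 3 → ℚ
  majorityWeight ω = ∑Op[ (λ f → (0ℚ <? ω f) ×-dec isMajority? f) ] ω

  minorityWeight : Weight D 3 → ℚ
  minorityWeight ω = ∑Op[ (λ f → (0ℚ <? ω f) ×-dec isMinority? f) ] ω

  data HasListedSupport : {k : ℕ} → Weight D k → Set a where
    binary : {ω : Weight D 2} →
      (∀ f → f ∈supp ω → IsIdempotent f × ¬ IsProjection f) →
      HasListedSupport ω
    majority : {ω : Weight D 3} →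
      (∀ f → f ∈supp ω → IsMajority f) →
      HasListedSupport ω
    minority : {ω : Weight D 3} →
      (∀ f → f ∈supp ω → IsMinority f) →
      HasListedSupport ω
    majority-minority : {ω : Weight D 3} →
      (∀ f → f ∈supp ω → IsMajority f ⊎ IsMinority f) →
      majorityWeight ω ≡ ℤ.+ 2 / 1 →
      minorityWeight ω ≡ ℤ.+ 1 / 1 →
      HasListedSupport ω
    semiprojection : {ω : Weight D k} → 3 ℕ.≤ k →
      (∀ f → f ∈supp ω → IsSemiprojection f) →
      HasListedSupport ω

{-# OPTIONS --safe #-}
module Submission where

-- Superposition with projections is always proper, so from a positive
-- weighting one can pass to minors (identify variables) until every minor is
-- supported on projections.  By rigidity all operations are idempotent, and an
-- arity of 2 only needs symmetrizing.  For larger arity, if some minor is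
-- non-zero, it can be superposed into a weighting whose support is any given
-- non-projection of the support clone.  If all minors vanish, the support
-- contains no projection, and for arity at least 4 Świerczkowski's lemma makes
-- it consist of semiprojections.
--
-- In arity 3 an operation all of whose minors are projections has one of eight
-- types.  If no majority operation occurs, vanishing of the minors leaves only
-- semiprojections.  Otherwise call majority and minority operations good and
-- the others bad.  Substituting the three rotations of a bad operation b into
-- the weighting gives a combination that replaces b by operations of which a
-- positive fraction is good.  This is an absorbing Markov chain on the bad
-- operations, and eliminating its states one by one (as in Gaussian
-- elimination) turns the projections into good operations only.  The minor of
-- the resulting weighting vanishes exactly if its majority and minority
-- operations have weights in the proportion 2 : 1.

open import Defs
open import Algebra.Bundles using (module CommutativeRing)
open import Data.Bool.Base using (Bool; true; false; not; if_then_else_)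
open import Data.Bool.Properties using () renaming (_≟_ to _≟ᴮ_)
open import Data.Fin.Base
  using (Fin; zero; suc; combine; finToFun; funToFin; punchIn; punchOut; splitAt; _↑ˡ_; _↑ʳ_)
open import Data.Fin.Properties as Fin
  using (2↔Bool; finToFun-funToFin; pigeonhole; punchIn-punchOut; punchOut-injective; splitAt-↑ˡ; splitAt-↑ʳ)
open import Data.Integer.Base as ℤ using ()
open import Data.List.Base as List using (List; []; _∷_)
open import Data.List.Relation.Unary.All as All using (All; []; _∷_)
open import Data.List.Relation.Unary.All.Properties using (tabulate⁻)
open import Data.Nat.Base as ℕ using (ℕ; zero; suc)
open import Data.Product.Base using (∃; ∃₂; _×_; _,_; proj₁; proj₂)
open import Data.Rational.Base
  using (ℚ; 0ℚ; 1ℚ; _+_; _*_; -_; 1/_; _/_; _≤_; _<_; NonZero; positive; nonNegative; ≢-nonZero)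
open import Data.Rational.Properties renaming (_≟_ to _≟ℚ_)
open import Data.Sum.Base using (_⊎_; inj₁; inj₂; [_,_]′)
open import Data.Vec.Base using (Vec; []; _∷_; lookup; tabulate; replicate)
import Data.Vec.Membership.DecPropositional as DecMembership
open import Data.Vec.Membership.Propositional using (_∈_; _∉_)
open import Data.Vec.Properties using (tabulate-cong; tabulate∘lookup; lookup∘tabulate)
open import Data.Vec.Relation.Unary.All using ([]; _∷_)
open import Data.Vec.Relation.Unary.Any using (here; there; index)
open import Data.Vec.Relation.Unary.Any.Properties using (lookup-index)
open import Data.Vec.Relation.Unary.Unique.Propositional using (Unique; []; _∷_)
open import Data.Vec.Relation.Unary.Unique.Propositional.Properties using (tabulate⁺)
open import Function.Base using (_∘_; _$_)
open import Function.Bundles using (_↔_; module Inverse)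
open import Function.Construct.Symmetry using (↔-sym)
open import Level using (Level; _⊔_)
open import Relation.Binary.Definitions using (DecidableEquality; tri<; tri≈; tri>)
open import Relation.Binary.PropositionalEquality hiding ([_])
open import Relation.Nullary.Decidable
  using (Dec; yes; no; does; map′; ¬?; decidable-stable; from-no; from-yes; _×-dec_; _⊎-dec_; _→-dec_)
open import Relation.Nullary.Negation using (¬_; contradiction)
open import Relation.Unary using (Pred; Decidable)

open import Algebra.Properties.Group +-0-group using (inverseˡ-unique; ⁻¹-involutive)
open import Algebra.Properties.Semiring.Sum (CommutativeRing.semiring +-*-commutativeRing)
  using (sum; sum-cong-≗; ∑-distrib-+; ∑-comm; *-distribˡ-sum; sum-replicate-zero)

private
  variable
    a c w p q : Level
    k ℓ m : ℕ

-- Signs of rational products and of finite sums.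

0≤* : ∀ {x y} → 0ℚ ≤ x → 0ℚ ≤ y → 0ℚ ≤ x * y
0≤* {x} {y} 0≤x 0≤y =
  subst (_≤ x * y) (*-zeroʳ x) (*-monoˡ-≤-nonNeg x ⦃ nonNegative 0≤x ⦄ 0≤y)

0<* : ∀ {x y} → 0ℚ < x → 0ℚ < y → 0ℚ < x * y
0<* {x} {y} 0<x 0<y =
  subst (_< x * y) (*-zeroʳ x) (*-monoʳ-<-pos x ⦃ positive 0<x ⦄ 0<y)

0<⇒≢0 : ∀ {x} → 0ℚ < x → ¬ (x ≡ 0ℚ)
0<⇒≢0 0<x x≡0 = <⇒≢ 0<x (sym x≡0)

<⇒≱ : ∀ {x y} → x < y → ¬ (y ≤ x)
<⇒≱ x<y y≤x = <-irrefl refl (<-≤-trans x<y y≤x)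

≤∧≢⇒< : ∀ {x y} → x ≤ y → ¬ (x ≡ y) → x < y
≤∧≢⇒< {x} {y} x≤y x≢y with <-cmp x y
... | tri< x<y _ _ = x<y
... | tri≈ _ e _   = contradiction e x≢y
... | tri> _ _ y<x = contradiction x≤y (<⇒≱ y<x)

sum-nonneg : ∀ {n} {t : Fin n → ℚ} → (∀ i → 0ℚ ≤ t i) → 0ℚ ≤ sum t
sum-nonneg {zero}  0≤t = ≤-refl
sum-nonneg {suc n} 0≤t = +-mono-≤ (0≤t zero) (sum-nonneg (0≤t ∘ suc))

sum-pos : ∀ {n} {t : Fin n → ℚ} → (∀ i → 0ℚ ≤ t i) → ∀ i → 0ℚ < t i → 0ℚ < sum t
sum-pos 0≤t zero    0<ti = +-mono-<-≤ 0<ti (sum-nonneg (0≤t ∘ suc))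
sum-pos 0≤t (suc i) 0<ti = +-mono-≤-< (0≤t zero) (sum-pos (0≤t ∘ suc) i 0<ti)

sum-zero : ∀ {n} {t : Fin n → ℚ} → (∀ i → t i ≡ 0ℚ) → sum t ≡ 0ℚ
sum-zero {n} t≡0 = trans (sum-cong-≗ t≡0) (sum-replicate-zero n)

sum-single : ∀ {n} {t : Fin n → ℚ} i → (∀ j → ¬ (j ≡ i) → t j ≡ 0ℚ) → sum t ≡ t i
sum-single {t = t} zero    t≡0 =
  trans (cong (t zero +_) (sum-zero λ j → t≡0 (suc j) λ ())) (+-identityʳ (t zero))
sum-single {t = t} (suc i) t≡0 =
  trans (cong₂ _+_ (t≡0 zero λ ()) (sum-single i λ j j≢i → t≡0 (suc j) (j≢i ∘ Fin.suc-injective)))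
        (+-identityˡ _)

-- The summand of ∑Op[_] at an operation of weight x.
infixr 8 [_]_
[_]_ : {P : Set p} → Dec P → ℚ → ℚ
[ d ] x = if does d then x else 0ℚ

[]-yes : {P : Set p} (d : Dec P) → P → ∀ x → [ d ] x ≡ x
[]-yes (yes _) _ x = refl
[]-yes (no ¬P) h x = contradiction h ¬P

[]-no : {P : Set p} (d : Dec P) → ¬ P → ∀ x → [ d ] x ≡ 0ℚ
[]-no (yes h) ¬P x = contradiction h ¬P
[]-no (no _)  _  x = refl

[]-cong : {P : Set p} {Q : Set q} (d : Dec P) (e : Dec Q) → (P → Q) → (Q → P) → ∀ x → [ d ] x ≡ [ e ] x
[]-cong (yes h) e f g x = sym ([]-yes e (f h) x)
[]-cong (no ¬P) e f g x = sym ([]-no e (¬P ∘ g) x)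

[]-* : {P : Set p} (d : Dec P) → ∀ x y → [ d ] (x * y) ≡ x * [ d ] y
[]-* (yes _) x y = refl
[]-* (no _)  x y = sym (*-zeroʳ x)

[]-*ˡ : {P : Set p} (d : Dec P) → ∀ x y → [ d ] (x * y) ≡ ([ d ] x) * y
[]-*ˡ (yes _) x y = refl
[]-*ˡ (no _)  x y = sym (*-zeroˡ y)

[]-+ : {P : Set p} (d : Dec P) → ∀ x y → [ d ] (x + y) ≡ [ d ] x + [ d ] y
[]-+ (yes _) x y = refl
[]-+ (no _)  x y = refl

[]-one : {P : Set p} (d : Dec P) → ∀ x → [ d ] x ≡ x * [ d ] 1ℚ
[]-one (yes _) x = sym (*-identityʳ x)
[]-one (no _)  x = sym (*-zeroʳ x)

[]-nonneg : {P : Set p} (d : Dec P) → ∀ {x} → (P → 0ℚ ≤ x) → 0ℚ ≤ [ d ] x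
[]-nonneg (yes h) 0≤x = 0≤x h
[]-nonneg (no _)  _   = ≤-refl

-- Sums over all operations and superposition of weights.

module Operations {D : Set a} {n : ℕ} (D↔Fin : D ↔ Fin n) where

  open FiniteSet D↔Fin
  open Inverse D↔Fin using (to)

  private
    funToFin-cong : ∀ {N} {f g : Fin k → Fin N} → f ≗ g → funToFin f ≡ funToFin g
    funToFin-cong {zero}  f≗g = refl
    funToFin-cong {suc k} f≗g = cong₂ combine (f≗g zero) (funToFin-cong (f≗g ∘ suc))

  opCode-cong : {f g : Op D k} → f ≗ g → opCode f ≡ opCode g
  opCode-cong {k} f≗g = funToFin-cong {n ℕ.^ k} λ j → cong to (f≗g (tuple j))

  -- The search runs over codes. `resp` is required because `op (opCode f)` agrees with `f` only
  -- pointwise.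
  anyOp? : {P : Pred (Op D k) p} → Decidable P → (∀ {f g} → f ≗ g → P f → P g) → Dec (∃ P)
  anyOp? P? resp = map′ (λ (i , h) → op i , h)
                        (λ (f , h) → opCode f , resp (sym ∘ op-opCode f) h)
                        (Fin.any? (P? ∘ op))

  isProjection? : Decidable (IsProjection {D = D} {k = k})
  isProjection? f = Fin.any? λ i → f ≗? proj i

  Extensional : Weight D k → Set a
  Extensional ω = ∀ {f g} → f ≗ g → ω f ≡ ω g

  opaque
    ∑ : Weight D k → ℚ
    ∑ = ∑Op

    ∑≡∑Op : (ω : Weight D k) → ∑ ω ≡ ∑Op ω
    ∑≡∑Op ω = refl

    ∑-cong : {ω ω′ : Weight D k} → ω ≗ ω′ → ∑ ω ≡ ∑ ω′
    ∑-cong ω≗ω′ = sum-cong-≗ (ω≗ω′ ∘ op)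

    ∑-+ : (ω ω′ : Weight D k) → ∑ (λ f → ω f + ω′ f) ≡ ∑ ω + ∑ ω′
    ∑-+ ω ω′ = ∑-distrib-+ (ω ∘ op) (ω′ ∘ op)

    ∑-* : ∀ x (ω : Weight D k) → ∑ (λ f → x * ω f) ≡ x * ∑ ω
    ∑-* x ω = sym (*-distribˡ-sum x (ω ∘ op))

    ∑-*ʳ : ∀ x (ω : Weight D k) → ∑ (λ f → ω f * x) ≡ ∑ ω * x
    ∑-*ʳ x ω = trans (∑-cong λ f → *-comm (ω f) x) (trans (∑-* x ω) (*-comm x (∑ ω)))

    ∑-swap : (F : Op D k → Op D ℓ → ℚ) →
             ∑ (λ f → ∑ λ g → F f g) ≡ ∑ (λ g → ∑ λ f → F f g)
    ∑-swap F = ∑-comm λ i j → F (op i) (op j)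

    ∑-nonneg : {ω : Weight D k} → (∀ f → 0ℚ ≤ ω f) → 0ℚ ≤ ∑ ω
    ∑-nonneg 0≤ω = sum-nonneg (0≤ω ∘ op)

    ∑-pos : {ω : Weight D k} → Extensional ω → (∀ f → 0ℚ ≤ ω f) → ∀ f → 0ℚ < ω f → 0ℚ < ∑ ω
    ∑-pos ext 0≤ω f 0<ωf =
      sum-pos (0≤ω ∘ op) (opCode f) (<-respʳ-≡ (ext (sym ∘ op-opCode f)) 0<ωf)

    ∑<0⇒∃<0 : {ω : Weight D k} → ∑ ω < 0ℚ → ∃ λ f → ω f < 0ℚ
    ∑<0⇒∃<0 {ω = ω} ∑<0 with Fin.any? (λ i → ω (op i) <? 0ℚ)
    ... | yes (i , ω<0) = op i , ω<0
    ... | no  ∄<0 = contradiction (sum-nonneg λ i → ≮⇒≥ λ h → ∄<0 (i , h)) (<⇒≱ ∑<0)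

    ∑≢0⇒∃≢0 : {ω : Weight D k} → ¬ (∑ ω ≡ 0ℚ) → ∃ λ f → ¬ (ω f ≡ 0ℚ)
    ∑≢0⇒∃≢0 {ω = ω} ∑≢0 with Fin.any? (λ i → ¬? (ω (op i) ≟ℚ 0ℚ))
    ... | yes (i , ω≢0) = op i , ω≢0
    ... | no  ∄≢0 = contradiction (sum-zero λ i → decidable-stable (ω (op i) ≟ℚ 0ℚ) λ h → ∄≢0 (i , h)) ∑≢0

    -- Among the numbered operations only `op (opCode g)` agrees pointwise with `g`, so one summand
    -- survives.
    ∑-single : {ω : Weight D k} → Extensional ω → ∀ g → ∑ (λ f → [ g ≗? f ] ω f) ≡ ω g
    ∑-single {k} {ω} ext g = begin
      ∑ (λ f → [ g ≗? f ] ω f)                ≡⟨ sum-single (opCode g) off ⟩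
      [ g ≗? op (opCode g) ] ω (op (opCode g))  ≡⟨ []-yes (g ≗? _) (sym ∘ op-opCode g) _ ⟩
      ω (op (opCode g))                         ≡⟨ ext (op-opCode g) ⟩
      ω g                                       ∎
      where
      open ≡-Reasoning
      off : ∀ j → ¬ (j ≡ opCode g) → [ g ≗? op j ] ω (op j) ≡ 0ℚ
      off j j≢ = []-no (g ≗? op j)
        (λ g≗ → j≢ (trans (sym (opCode-op {k} j)) (opCode-cong (sym ∘ g≗)))) _

  ⟦⟧-congʳ : (f : Op D k) {gs gs′ : Fin k → Op D ℓ} → (∀ i → gs i ≗ gs′ i) → f ⟦ gs ⟧ ≗ f ⟦ gs′ ⟧
  ⟦⟧-congʳ f gs≗gs′ xs = cong f (tabulate-cong λ i → gs≗gs′ i xs)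

  proj-⟦⟧ : (i : Fin k) (gs : Fin k → Op D ℓ) → proj i ⟦ gs ⟧ ≗ gs i
  proj-⟦⟧ i gs xs = lookup∘tabulate (λ i → gs i xs) i

  ⟦proj⟧ : (f : Op D k) → f ⟦ proj ⟧ ≗ f
  ⟦proj⟧ f xs = cong f (tabulate∘lookup xs)

  infixl 9 _⟪_⟫
  opaque
    _⟪_⟫ : Weight D k → (Fin k → Op D ℓ) → Weight D ℓ
    ω ⟪ gs ⟫ = superposeWeight D↔Fin ω gs

  module _ {gs : Fin k → Op D ℓ} where

    private
      term : Weight D k → Op D ℓ → Weight D k
      term ω g f = [ (f ⟦ gs ⟧) ≗? g ] ω f

    opaque
      unfolding ∑ _⟪_⟫

      ⟪⟫≡∑ : (ω : Weight D k) (g : Op D ℓ) → (ω ⟪ gs ⟫) g ≡ ∑ (λ f → [ (f ⟦ gs ⟧) ≗? g ] ω f)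
      ⟪⟫≡∑ ω g = refl

      ⟪⟫-congˡ : {ω ω′ : Weight D k} → ω ≗ ω′ → ω ⟪ gs ⟫ ≗ ω′ ⟪ gs ⟫
      ⟪⟫-congˡ ω≗ω′ g = ∑-cong λ f → cong ([ (f ⟦ gs ⟧) ≗? g ]_) (ω≗ω′ f)

      -- A value of a superposed weight depends only on the fibre of operations mapped to that
      -- point, so comparing fibres is enough.
      ⟪⟫-match : {hs : Fin k → Op D m} (ω : Weight D k) {g : Op D ℓ} {h : Op D m} →
                 (∀ f → f ⟦ gs ⟧ ≗ g → f ⟦ hs ⟧ ≗ h) → (∀ f → f ⟦ hs ⟧ ≗ h → f ⟦ gs ⟧ ≗ g) →
                 (ω ⟪ gs ⟫) g ≡ (ω ⟪ hs ⟫) h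
      ⟪⟫-match {hs = hs} ω {g} {h} to from =
        ∑-cong λ f → []-cong ((f ⟦ gs ⟧) ≗? g) ((f ⟦ hs ⟧) ≗? h) (to f) (from f) (ω f)

      ⟪⟫-ext : (ω : Weight D k) → Extensional (ω ⟪ gs ⟫)
      ⟪⟫-ext ω g≗h = ⟪⟫-match {hs = gs} ω (λ f e xs → trans (e xs) (g≗h xs))
                                    (λ f e xs → trans (e xs) (sym (g≗h xs)))

      ⟪⟫-+ : (ω ω′ : Weight D k) → ((λ f → ω f + ω′ f) ⟪ gs ⟫) ≗ λ g → (ω ⟪ gs ⟫) g + (ω′ ⟪ gs ⟫) g
      ⟪⟫-+ ω ω′ g = trans (∑-cong λ f → []-+ ((f ⟦ gs ⟧) ≗? g) (ω f) (ω′ f)) (∑-+ (term ω g) (term ω′ g))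

      ⟪⟫-* : ∀ x (ω : Weight D k) → ((λ f → x * ω f) ⟪ gs ⟫) ≗ λ g → x * (ω ⟪ gs ⟫) g
      ⟪⟫-* x ω g = trans (∑-cong λ f → []-* ((f ⟦ gs ⟧) ≗? g) x (ω f)) (∑-* x (term ω g))

      -- Change of variables: `ω ⟪ gs ⟫` is the push-forward of `ω` along `f ↦ f ⟦ gs ⟧`.
      ⟪⟫-pairing : (ω : Weight D k) {φ : Weight D ℓ} → Extensional φ →
                   ∑ (λ g → (ω ⟪ gs ⟫) g * φ g) ≡ ∑ (λ f → ω f * φ (f ⟦ gs ⟧))
      ⟪⟫-pairing ω {φ} ext = begin
        ∑ (λ g → (ω ⟪ gs ⟫) g * φ g)                        ≡⟨ ∑-cong (λ g → ∑-*ʳ (φ g) (term ω g)) ⟨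
        ∑ (λ g → ∑ λ f → ([ (f ⟦ gs ⟧) ≗? g ] ω f) * φ g)  ≡⟨ ∑-swap {ℓ} {k} (λ g f → [ (f ⟦ gs ⟧) ≗? g ] ω f * φ g) ⟩
        ∑ (λ f → ∑ λ g → [ (f ⟦ gs ⟧) ≗? g ] ω f * φ g)  ≡⟨ ∑-cong {k} (λ f → ∑-cong {ℓ} λ g →
                                                                 []-*ˡ ((f ⟦ gs ⟧) ≗? g) (ω f) (φ g)) ⟨
        ∑ (λ f → ∑ λ g → [ (f ⟦ gs ⟧) ≗? g ] (ω f * φ g))  ≡⟨ ∑-cong {k} (λ f →
                                                                 ∑-single (cong (ω f *_) ∘ ext) (f ⟦ gs ⟧)) ⟩
        ∑ (λ f → ω f * φ (f ⟦ gs ⟧))                        ∎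
        where open ≡-Reasoning

      ⟪⟫-sum : (ω : Weight D k) → ∑ (ω ⟪ gs ⟫) ≡ ∑ ω
      ⟪⟫-sum ω = begin
        ∑ (ω ⟪ gs ⟫)                ≡⟨ ∑-cong {ℓ} (λ g → *-identityʳ ((ω ⟪ gs ⟫) g)) ⟨
        ∑ (λ g → (ω ⟪ gs ⟫) g * 1ℚ)  ≡⟨ ⟪⟫-pairing ω {λ _ → 1ℚ} (λ _ → refl) ⟩
        ∑ (λ f → ω f * 1ℚ)          ≡⟨ ∑-cong (λ f → *-identityʳ (ω f)) ⟩
        ∑ ω                         ∎
        where open ≡-Reasoning

      -- This is `⟪⟫-pairing` applied to the indicator function of the fibre of `g` under
      -- superposition with `hs`.
      ⟪⟫-∘ : (ω : Weight D k) (hs : Fin ℓ → Op D m) →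
             (ω ⟪ gs ⟫ ⟪ hs ⟫) ≗ (ω ⟪ (λ i → gs i ⟦ hs ⟧) ⟫)
      ⟪⟫-∘ ω hs g = begin
        ∑ (λ f → [ (f ⟦ hs ⟧) ≗? g ] (ω ⟪ gs ⟫) f)          ≡⟨ ∑-cong {ℓ} (λ f → []-one ((f ⟦ hs ⟧) ≗? g) ((ω ⟪ gs ⟫) f)) ⟩
        ∑ (λ f → (ω ⟪ gs ⟫) f * [ (f ⟦ hs ⟧) ≗? g ] 1ℚ)     ≡⟨ ⟪⟫-pairing ω ext ⟩
        ∑ (λ f → ω f * [ (f ⟦ gs ⟧ ⟦ hs ⟧) ≗? g ] 1ℚ)       ≡⟨ ∑-cong (λ f → []-one ((f ⟦ gs ⟧ ⟦ hs ⟧) ≗? g) (ω f)) ⟨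
        ∑ (λ f → [ (f ⟦ gs ⟧ ⟦ hs ⟧) ≗? g ] ω f)            ≡⟨ ∑-cong (λ f →
            []-cong ((f ⟦ gs ⟧ ⟦ hs ⟧) ≗? g) ((f ⟦ (λ i → gs i ⟦ hs ⟧) ⟧) ≗? g)
              (λ e xs → trans (sym (assoc f xs)) (e xs)) (λ e xs → trans (assoc f xs) (e xs)) (ω f)) ⟩
        (ω ⟪ (λ i → gs i ⟦ hs ⟧) ⟫) g                         ∎
        where
        open ≡-Reasoning
        assoc : ∀ f → f ⟦ gs ⟧ ⟦ hs ⟧ ≗ f ⟦ (λ i → gs i ⟦ hs ⟧) ⟧
        assoc f xs = refl
        ext : Extensional λ f → [ (f ⟦ hs ⟧) ≗? g ] 1ℚ
        ext {f} {f′} f≗f′ = []-cong ((f ⟦ hs ⟧) ≗? g) ((f′ ⟦ hs ⟧) ≗? g)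
          (λ e xs → trans (sym (f≗f′ _)) (e xs)) (λ e xs → trans (f≗f′ _) (e xs)) 1ℚ

      private
        term-source : {P : ℚ → Set} → ¬ P 0ℚ → (ω : Weight D k) → ∀ f {g} →
                      P ([ (f ⟦ gs ⟧) ≗? g ] ω f) → f ⟦ gs ⟧ ≗ g × P (ω f)
        term-source ¬P0 ω f {g} Pf with (f ⟦ gs ⟧) ≗? g
        ... | yes e = e , Pf
        ... | no _  = contradiction Pf ¬P0

      ⟪⟫-source≢0 : (ω : Weight D k) {g : Op D ℓ} → ¬ ((ω ⟪ gs ⟫) g ≡ 0ℚ) →
                    ∃ λ f → f ⟦ gs ⟧ ≗ g × ¬ (ω f ≡ 0ℚ)
      ⟪⟫-source≢0 ω ≢0 with f , h ← ∑≢0⇒∃≢0 ≢0 =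
        f , term-source {P = λ x → ¬ (x ≡ 0ℚ)} (λ h → h refl) ω f h

      ⟪⟫-source<0 : (ω : Weight D k) {g : Op D ℓ} → (ω ⟪ gs ⟫) g < 0ℚ →
                    ∃ λ f → f ⟦ gs ⟧ ≗ g × ω f < 0ℚ
      ⟪⟫-source<0 ω <0 with f , h ← ∑<0⇒∃<0 <0 =
        f , term-source {P = _< 0ℚ} (<-irrefl refl) ω f h

      -- No cancellation occurs when the whole fibre of `g` has non-negative weight.
      ⟪⟫-pos : {ω : Weight D k} → Extensional ω → {g : Op D ℓ} →
               (∀ f → f ⟦ gs ⟧ ≗ g → 0ℚ ≤ ω f) → ∀ f → f ⟦ gs ⟧ ≗ g → 0ℚ < ω f → 0ℚ < (ω ⟪ gs ⟫) g
      ⟪⟫-pos {ω} ext {g} 0≤ω f e 0<ωf =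
        ∑-pos ext′ (λ f → []-nonneg ((f ⟦ gs ⟧) ≗? g) (0≤ω f)) f
              (<-respʳ-≡ (sym ([]-yes ((f ⟦ gs ⟧) ≗? g) e (ω f))) 0<ωf)
        where
        ext′ : Extensional λ f → [ (f ⟦ gs ⟧) ≗? g ] ω f
        ext′ {f} {f′} f≗f′ = trans
          ([]-cong ((f ⟦ gs ⟧) ≗? g) ((f′ ⟦ gs ⟧) ≗? g)
            (λ e xs → trans (sym (f≗f′ _)) (e xs)) (λ e xs → trans (f≗f′ _) (e xs)) (ω f))
          (cong ([ (f′ ⟦ gs ⟧) ≗? g ]_) (ext f≗f′))

  ⟪⟫-congʳ : (ω : Weight D k) {gs gs′ : Fin k → Op D ℓ} → (∀ i → gs i ≗ gs′ i) →
             ω ⟪ gs ⟫ ≗ ω ⟪ gs′ ⟫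
  ⟪⟫-congʳ ω {gs} {gs′} gs≗gs′ g = ⟪⟫-match {gs = gs} {hs = gs′} ω
    (λ f e xs → trans (sym (⟦⟧-congʳ f gs≗gs′ xs)) (e xs))
    (λ f e xs → trans (⟦⟧-congʳ f gs≗gs′ xs) (e xs))

  opaque
    unfolding ∑ _⟪_⟫

    ⟪proj⟫ : {ω : Weight D k} → Extensional ω → ω ⟪ proj ⟫ ≗ ω
    ⟪proj⟫ {ω = ω} ext g = trans
      (∑-cong λ f → []-cong ((f ⟦ proj ⟧) ≗? g) (g ≗? f)
        (λ e xs → trans (sym (e xs)) (⟦proj⟧ f xs)) (λ e xs → trans (⟦proj⟧ f xs) (sym (e xs))) (ω f))
      (∑-single ext g)

-- Minors and Świerczkowski's lemma.

infix 4 _∈?_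
_∈?_ : ∀ {n} (i : Fin n) (v : Vec (Fin n) m) → Dec (i ∈ v)
i ∈? v = DecMembership._∈?_ Fin._≟_ i v

-- If every index occurred in `v`, two different ones would share a position of `v`.
fresh : ∀ {n} → m ℕ.< n → (v : Vec (Fin n) m) → ∃ λ i → i ∉ v
fresh m<n v with Fin.any? (λ i → ¬? (i ∈? v))
... | yes i∉v = i∉v
... | no ∄i =
  let i , j , i<j , e = pigeonhole m<n (index ∘ mem)
  in contradiction (trans (lookup-index (mem i)) (trans (cong (lookup v) e) (sym (lookup-index (mem j)))))
                   (Fin.<⇒≢ i<j)
  where
  mem : ∀ i → i ∈ v
  mem i = decidable-stable (i ∈? v) λ i∉v → ∄i (i , i∉v)

module Minors {D : Set a} (_≟D_ : DecidableEquality D) {x₀ x₁ : D} (x₀≢x₁ : ¬ (x₀ ≡ x₁)) where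

  private
    -- Two-valued test tuples. Evaluating at them reveals which variable an operation returns.
    χ : Vec (Fin k) m → Vec D k
    χ v = tabulate λ i → if does (i ∈? v) then x₀ else x₁

    χ-∈ : (v : Vec (Fin k) m) → ∀ {i} → i ∈ v → lookup (χ v) i ≡ x₀
    χ-∈ v {i} i∈v = trans (lookup∘tabulate _ i) (eq (i ∈? v))
      where
      eq : (d : Dec (i ∈ v)) → (if does d then x₀ else x₁) ≡ x₀
      eq (yes _)  = refl
      eq (no i∉v) = contradiction i∈v i∉v

    χ-∉ : (v : Vec (Fin k) m) → ∀ {i} → i ∉ v → lookup (χ v) i ≡ x₁
    χ-∉ v {i} i∉v = trans (lookup∘tabulate _ i) (eq (i ∈? v))
      where
      eq : (d : Dec (i ∈ v)) → (if does d then x₀ else x₁) ≡ x₁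
      eq (yes i∈v) = contradiction i∈v i∉v
      eq (no _)    = refl

    χ-≡⇒∈ : (v : Vec (Fin k) m) → ∀ {i j} → i ∈ v → lookup (χ v) i ≡ lookup (χ v) j → j ∈ v
    χ-≡⇒∈ v {i} {j} i∈v e = decidable-stable (j ∈? v) λ j∉v →
      x₀≢x₁ (trans (sym (χ-∈ v i∈v)) (trans e (χ-∉ v j∉v)))

  proj-injective : {i j : Fin k} → proj {D = D} i ≗ proj j → i ≡ j
  proj-injective {i = i} {j} e with here j≡i ← χ-≡⇒∈ (i ∷ []) {i} {j} (here refl) (e (χ (i ∷ []))) = sym j≡i

  -- The minor identifying variables `i` and `j` is a projection, named by a variable `s` of `f`
  -- itself. Consequently `s = i` and `s = j` express the same condition.
  ActsAs : Op D k → Fin k → Fin k → Fin k → Set a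
  ActsAs f i j s = ∀ xs → lookup xs i ≡ lookup xs j → f xs ≡ lookup xs s

  HasMinors : Op D k → Set a
  HasMinors f = ∀ {i j} → ¬ (i ≡ j) → ∃ λ s → ActsAs f i j s

  -- Variable `j` is merged into another one, whose index `i` is counted after the deletion of `j`.
  collapse : ∀ {m} → Fin (suc m) → Fin m → Fin (suc m) → Fin m
  collapse j i t with j Fin.≟ t
  ... | yes _   = i
  ... | no  j≢t = punchOut j≢t

  -- A tuple with equal entries at `i` and `j` can be restored after its entry `j` is deleted, so
  -- its value is already a value of a minor.
  hasMinors : ∀ {m} (f : Op D (suc m)) →
              (∀ (π : Fin (suc m) → Fin m) → IsProjection (f ⟦ proj ∘ π ⟧)) → HasMinors f
  hasMinors {m} f projs {i} {j} i≢j with s , e ← projs (collapse j (punchOut (i≢j ∘ sym))) =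
    punchIn j s , λ xs xsᵢ≡xsⱼ → begin
      f xs                                                     ≡⟨ cong f (tabulate∘lookup xs) ⟨
      f (tabulate (lookup xs))                                 ≡⟨ cong f (tabulate-cong λ t → restore xs xsᵢ≡xsⱼ t) ⟨
      f (tabulate λ t → lookup (drop xs) (collapse j i′ t))    ≡⟨ e (drop xs) ⟩
      lookup (drop xs) s                                       ≡⟨ lookup∘tabulate _ s ⟩
      lookup xs (punchIn j s)                                  ∎
    where
    open ≡-Reasoning
    i′ : Fin m
    i′ = punchOut (i≢j ∘ sym)
    drop : Vec D (suc m) → Vec D m
    drop xs = tabulate (lookup xs ∘ punchIn j)
    restore : ∀ xs → lookup xs i ≡ lookup xs j → ∀ t →
              lookup (drop xs) (collapse j i′ t) ≡ lookup xs t
    restore xs xsᵢ≡xsⱼ t with j Fin.≟ t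
    ... | yes refl = trans (lookup∘tabulate _ i′)
                       (trans (cong (lookup xs) (punchIn-punchOut (i≢j ∘ sym))) xsᵢ≡xsⱼ)
    ... | no  j≢t  = trans (lookup∘tabulate _ (punchOut j≢t)) (cong (lookup xs) (punchIn-punchOut j≢t))

  repeated : (xs : Vec D k) → ¬ Unique xs → ∃₂ λ i j → ¬ (i ≡ j) × lookup xs i ≡ lookup xs j
  repeated xs ¬unique
    with Fin.any? (λ i → Fin.any? λ j → ¬? (i Fin.≟ j) ×-dec (lookup xs i ≟D lookup xs j))
  ... | yes h = h
  ... | no ∄  = contradiction
    (subst Unique (tabulate∘lookup xs) (tabulate⁺ λ {i} {j} e →
      decidable-stable (i Fin.≟ j) λ i≢j → ∄ (i , j , i≢j , e)))
    ¬unique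

  private
    module Swierczkowski {k} (f : Op D (4 ℕ.+ k)) (minors : HasMinors f) where

      χ-∉² : {i j s : Fin (4 ℕ.+ k)} → s ∉ (i ∷ j ∷ []) → lookup (χ (s ∷ [])) i ≡ lookup (χ (s ∷ [])) j
      χ-∉² {s = s} s∉ = trans (χ-∉ (s ∷ []) λ { (here e) → s∉ (here (sym e)) })
                              (sym (χ-∉ (s ∷ []) λ { (here e) → s∉ (there (here (sym e))) }))

      -- The tuple with `x₀` at `s` alone has equal entries at `i`, `j` and at `p`, `q`, so both
      -- minors apply to it. Its value `x₀` can only come from position `s`.
      agree : ∀ {i j p q s t} → ActsAs f i j s → s ∉ (i ∷ j ∷ []) →
              ActsAs f p q t → s ∉ (p ∷ q ∷ []) → t ≡ s
      agree {i} {j} {p} {q} {s} {t} f-ij s∉ij f-pq s∉pq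
        with here t≡s ← χ-≡⇒∈ (s ∷ []) {s} {t} (here refl)
               (trans (sym (f-ij (χ (s ∷ [])) (χ-∉² s∉ij))) (f-pq (χ (s ∷ [])) (χ-∉² s∉pq)))
        = t≡s

      module _ {i j s} (f-ij : ActsAs f i j s) (s∉ij : s ∉ (i ∷ j ∷ [])) where

        at : ∀ {q} → ¬ (s ≡ q) → ActsAs f s q s
        at {q} s≢q with t , f-sq ← minors s≢q with t ∈? (s ∷ q ∷ [])
        ... | yes (here refl)         = f-sq
        ... | yes (there (here refl)) = λ xs e → trans (f-sq xs e) (sym e)
        -- Here a fourth variable `g` is needed. By `agree`, identifying `t` with `g` returns `s`,
        -- whereas identifying `s` with `q` returns `t`. The tuple with `x₀` exactly at `s` and `q`
        -- satisfies both identifications and gives contradictory values.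
        ... | no t∉sq
          with g , g∉ ← fresh (ℕ.s≤s (ℕ.s≤s (ℕ.s≤s (ℕ.s≤s ℕ.z≤n)))) (t ∷ s ∷ q ∷ [])
          with u , f-tg ← minors {t} {g} (λ e → g∉ (here (sym e)))
          with refl ← agree f-ij s∉ij f-tg
                 (λ { (here e) → t∉sq (here (sym e)) ; (there (here e)) → g∉ (there (here (sym e))) })
          = contradiction
              (begin
                x₀                             ≡⟨ χ-∈ (s ∷ q ∷ []) (here refl) ⟨
                lookup (χ (s ∷ q ∷ [])) s      ≡⟨ f-tg (χ (s ∷ q ∷ []))
                                                  (trans (χ-∉ (s ∷ q ∷ []) t∉sq) (sym (χ-∉ (s ∷ q ∷ []) (g∉ ∘ there)))) ⟨
                f (χ (s ∷ q ∷ []))             ≡⟨ f-sq (χ (s ∷ q ∷ []))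
                                                  (trans (χ-∈ (s ∷ q ∷ []) (here refl))
                                                         (sym (χ-∈ (s ∷ q ∷ []) (there (here refl))))) ⟩
                lookup (χ (s ∷ q ∷ [])) t      ≡⟨ χ-∉ (s ∷ q ∷ []) t∉sq ⟩
                x₁                             ∎)
              x₀≢x₁
          where open ≡-Reasoning

        everywhere : ∀ {p q} → ¬ (p ≡ q) → ActsAs f p q s
        everywhere {p} {q} p≢q with t , f-pq ← minors p≢q with s Fin.≟ p | s Fin.≟ q
        ... | yes refl | _        = at p≢q
        ... | no _     | yes refl = λ xs e → at (p≢q ∘ sym) xs (sym e)
        ... | no s≢p   | no s≢q
          with refl ← agree f-ij s∉ij f-pq
                 (λ { (here e) → s≢p e ; (there (here e)) → s≢q e }) = f-pq

      -- One of the disjoint pairs {0,1} and {2,3} has a minor returning a variable outside the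
      -- pair. If the first pair returns one of its own variables, the tuple with `x₀` exactly at 0
      -- and 1 shows that the second pair returns 0 or 1 as well.
      result : ∃ λ s → ∀ {p q} → ¬ (p ≡ q) → ActsAs f p q s
      result
        with s , f-01 ← minors {zero} {suc zero} (λ ())
        with t , f-23 ← minors {suc (suc zero)} {suc (suc (suc zero))} (λ ())
        with s ∈? (zero ∷ suc zero ∷ [])
      ... | no s∉  = s , everywhere f-01 s∉
      ... | yes s∈ = t , everywhere f-23 (disjoint (χ-≡⇒∈ v s∈
              (trans (sym (f-01 (χ v) (trans (χ-∈ v (here refl)) (sym (χ-∈ v (there (here refl)))))))
                     (f-23 (χ v) (trans (χ-∉ v {suc (suc zero)} λ { (there (there ())) })
                                        (sym (χ-∉ v {suc (suc (suc zero))} λ { (there (there ())) })))))))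
        where
        v : Vec (Fin (4 ℕ.+ k)) 2
        v = zero ∷ suc zero ∷ []
        disjoint : ∀ {t} → t ∈ v → t ∉ (suc (suc zero) ∷ suc (suc (suc zero)) ∷ [])
        disjoint (here refl)         (there (there ()))
        disjoint (there (here refl)) (there (there ()))

  -- Świerczkowski's lemma.
  semiprojection-from-minors :
    (f : Op D (4 ℕ.+ k)) → HasMinors f → ¬ IsProjection f → IsSemiprojection f
  semiprojection-from-minors f minors ¬proj with s , acts ← Swierczkowski.result f minors =
    ¬proj , s , λ xs ¬unique → let i , j , i≢j , e = repeated xs ¬unique in acts i≢j xs e

-- The cone of superpositions that need not be proper.

module Combinations {D : Set a} {n : ℕ} (D↔Fin : D ↔ Fin n) (W : WeightedClone D↔Fin c w) where

  open FiniteSet D↔Fin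
  open Operations D↔Fin
  open WeightedClone W
  open IsWeighting

  -- Superpositions of members of W that need not be proper.  They form a
  -- convex cone closed under superposition, whose weightings belong to W.
  record Combination (ρ : Weight D ℓ) : Set (a ⊔ c ⊔ w) where
    field
      {arity} : ℕ
      weight  : Weight D arity
      ops     : Fin arity → Op D ℓ
      weight∈W : weight ∈W
      ops∈C   : ∀ i → ops i ∈C
      eq      : ρ ≗ weight ⟪ ops ⟫

  open Combination

  ∈W-ext : {ω : Weight D k} → ω ∈W → Extensional ω
  ∈W-ext ω∈W = resp-≗ (isWeighting ω∈W)

  ∈W-sum : {ω : Weight D k} → ω ∈W → ∑ ω ≡ 0ℚ
  ∈W-sum {ω = ω} ω∈W = trans (∑≡∑Op ω) (sum≡0 (isWeighting ω∈W))

  module _ {ρ : Weight D ℓ} (R : Combination ρ) where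

    combination-ext : Extensional ρ
    combination-ext {f} {g} f≗g = trans (eq R f) (trans (⟪⟫-ext (weight R) f≗g) (sym (eq R g)))

    combination-≢0⇒∈C : ∀ f → ¬ (ρ f ≡ 0ℚ) → f ∈C
    combination-≢0⇒∈C f ρf≢0
      with h , e , ωh≢0 ← ⟪⟫-source≢0 {gs = ops R} (weight R) {f} (ρf≢0 ∘ trans (eq R f)) =
      ∈C-resp-≗ e (superpose-∈C (vanishes (isWeighting (weight∈W R)) h ωh≢0) (ops∈C R))

    combination-sum : ∑ ρ ≡ 0ℚ
    combination-sum = trans (∑-cong (eq R)) (trans (⟪⟫-sum {gs = ops R} (weight R)) (∈W-sum (weight∈W R)))

    opaque
      unfolding ∑ _⟪_⟫

      -- Vanishing outside the clone and total weight zero hold for every superposition, so only the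
      -- sign condition decides whether it is proper.
      combination-∈W : (∀ f → ρ f < 0ℚ → IsProjection f) → ρ ∈W
      combination-∈W neg = ∈W-resp-≗ (sym ∘ eq R) (superpose-∈W (weight∈W R) (ops∈C R) record
        { resp-≗   = ⟪⟫-ext (weight R)
        ; vanishes = λ f ≢0 → combination-≢0⇒∈C f (≢0 ∘ trans (sym (eq R f)))
        ; negative = λ f <0 → neg f (<-respˡ-≡ (sym (eq R f)) <0)
        ; sum≡0    = trans (sym (∑-cong (eq R))) combination-sum
        })

    combination-⟪⟫ : {hs : Fin ℓ → Op D m} → (∀ i → hs i ∈C) → Combination (ρ ⟪ hs ⟫)
    combination-⟪⟫ {hs = hs} hs∈C = record
      { weight = weight R
      ; ops    = λ i → ops R i ⟦ hs ⟧
      ; weight∈W = weight∈W R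
      ; ops∈C  = λ i → superpose-∈C (ops∈C R i) hs∈C
      ; eq     = λ f → trans (⟪⟫-congˡ (eq R) f) (⟪⟫-∘ (weight R) hs f)
      }

    combination-* : ∀ {x} → 0ℚ ≤ x → Combination (λ f → x * ρ f)
    combination-* {x} 0≤x = record
      { weight = λ f → x * weight R f
      ; ops    = ops R
      ; weight∈W = scale-∈W x 0≤x (weight∈W R)
      ; ops∈C  = ops∈C R
      ; eq     = λ f → trans (cong (x *_) (eq R f)) (sym (⟪⟫-* x (weight R) f))
      }

  ∈W⇒combination : {ω : Weight D k} → ω ∈W → Combination ω
  ∈W⇒combination {ω = ω} ω∈W = record
    { weight = ω
    ; ops    = proj
    ; weight∈W = ω∈W
    ; ops∈C  = proj-∈C
    ; eq     = sym ∘ ⟪proj⟫ (∈W-ext ω∈W)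
    }

  -- Substituting projections sends projections to projections, so negative weight can land nowhere
  -- else.
  relabel-∈W : {ω : Weight D k} → ω ∈W → (π : Fin k → Fin ℓ) → ω ⟪ proj ∘ π ⟫ ∈W
  relabel-∈W {ω = ω} ω∈W π =
    combination-∈W (combination-⟪⟫ (∈W⇒combination ω∈W) (proj-∈C ∘ π)) negative′
    where
    negative′ : ∀ f → (ω ⟪ proj ∘ π ⟫) f < 0ℚ → IsProjection f
    negative′ f <0
      with h , e , ωh<0 ← ⟪⟫-source<0 {gs = proj ∘ π} ω <0
      with i , h≗i ← negative (isWeighting ω∈W) h ωh<0 =
      π i , λ xs → trans (sym (e xs)) (trans (h≗i _) (proj-⟦⟧ i (proj ∘ π) xs))

  -- Both weightings are moved to disjoint sets of variables, where their
  -- sum lies in W, and are then superposed at once.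
  combination-+ : {ρ ρ′ : Weight D ℓ} → Combination ρ → Combination ρ′ →
                  Combination (λ f → ρ f + ρ′ f)
  combination-+ {ℓ} {ρ} {ρ′} R R′ = record
    { weight = λ f → (weight R ⟪ proj ∘ left ⟫) f + (weight R′ ⟪ proj ∘ right ⟫) f
    ; ops    = both
    ; weight∈W = +-∈W (relabel-∈W (weight∈W R) left) (relabel-∈W (weight∈W R′) right)
    ; ops∈C  = both∈C
    ; eq     = λ f → trans
        (cong₂ _+_
          (trans (eq R f) (sym (trans (⟪⟫-∘ (weight R) both f) (⟪⟫-congʳ (weight R) onLeft f))))
          (trans (eq R′ f) (sym (trans (⟪⟫-∘ (weight R′) both f) (⟪⟫-congʳ (weight R′) onRight f)))))
        (sym (⟪⟫-+ {gs = both} (weight R ⟪ proj ∘ left ⟫) (weight R′ ⟪ proj ∘ right ⟫) f))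
    }
    where
    left : Fin (arity R) → Fin (arity R ℕ.+ arity R′)
    left i = i ↑ˡ arity R′
    right : Fin (arity R′) → Fin (arity R ℕ.+ arity R′)
    right i = arity R ↑ʳ i
    both : Fin (arity R ℕ.+ arity R′) → Op D ℓ
    both i = [ ops R , ops R′ ]′ (splitAt (arity R) i)
    both∈C : ∀ i → both i ∈C
    both∈C i with splitAt (arity R) i
    ... | inj₁ j = ops∈C R j
    ... | inj₂ j = ops∈C R′ j
    onLeft : ∀ i → proj (left i) ⟦ both ⟧ ≗ ops R i
    onLeft i xs = trans (proj-⟦⟧ (left i) both xs)
      (cong (λ s → [ ops R , ops R′ ]′ s xs) (splitAt-↑ˡ (arity R) i (arity R′)))
    onRight : ∀ i → proj (right i) ⟦ both ⟧ ≗ ops R′ i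
    onRight i xs = trans (proj-⟦⟧ (right i) both xs)
      (cong (λ s → [ ops R , ops R′ ]′ s xs) (splitAt-↑ʳ (arity R) (arity R′) i))

  -- Otherwise `- ω` would be non-negative everywhere and positive at `g`, which contradicts the
  -- zero sum.
  ∃>0 : {ω : Weight D k} → Extensional ω → ∑ ω ≡ 0ℚ → ∀ g → ¬ (ω g ≡ 0ℚ) → ∃ λ f → 0ℚ < ω f
  ∃>0 {ω = ω} ext ∑≡0 g ωg≢0 with anyOp? (λ f → 0ℚ <? ω f) (λ e → <-respʳ-≡ (ext e))
  ... | yes h  = h
  ... | no ∄>0 = contradiction ∑-ω≡0 (0<⇒≢0 (∑-pos (cong -_ ∘ ext) (λ f → neg-antimono-≤ (ω≤0 f)) g
                   (neg-antimono-< (≤∧≢⇒< (ω≤0 g) ωg≢0))))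
    where
    ω≤0 : ∀ f → ω f ≤ 0ℚ
    ω≤0 f = ≮⇒≥ λ 0<ω → ∄>0 (f , 0<ω)
    ∑-ω≡0 : ∑ (λ f → - ω f) ≡ 0ℚ
    ∑-ω≡0 = begin
      ∑ (λ f → - ω f)       ≡⟨ ∑-cong (λ f → trans (cong -_ (sym (*-identityˡ (ω f)))) (neg-distribˡ-* 1ℚ (ω f))) ⟩
      ∑ (λ f → - 1ℚ * ω f)  ≡⟨ ∑-* (- 1ℚ) ω ⟩
      - 1ℚ * ∑ ω            ≡⟨ cong (- 1ℚ *_) ∑≡0 ⟩
      - 1ℚ * 0ℚ               ≡⟨ *-zeroʳ (- 1ℚ) ⟩
      0ℚ                      ∎
      where open ≡-Reasoning

  -- If ρ puts positive weight x on the projection to variable l and all its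
  -- weight on projections, then substituting f for l and e₁ for the other
  -- variables leaves x on f and -x on e₁.
  singleton-support :
    {ρ : Weight D m} → Combination ρ →
    (∀ g → ¬ (ρ g ≡ 0ℚ) → IsProjection g) → (∃ λ g → ¬ (ρ g ≡ 0ℚ)) →
    {f : Op D (suc k)} → f ∈C → ¬ IsProjection f →
    ∃ λ (ω : Weight D (suc k)) → ω ∈W × (f ∈supp ω) × (∀ g → g ∈supp ω → g ≗ f)
  singleton-support {m} {k} {ρ} R onProj (g , ρg≢0) {f} f∈C ¬proj
    with h , 0<ρh ← ∃>0 (combination-ext R) (combination-sum R) g ρg≢0
    with l , h≗l ← onProj h (0<⇒≢0 0<ρh) = ρ ⟪ gs ⟫ , ∈W′ , positive-f , only-f
    where
    0<ρl : 0ℚ < ρ (proj l)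
    0<ρl = <-respʳ-≡ (combination-ext R h≗l) 0<ρh
    choose : ∀ {i} → Dec (i ≡ l) → Op D (suc k)
    choose (yes _) = f
    choose (no _)  = proj zero
    gs : Fin m → Op D (suc k)
    gs i = choose (i Fin.≟ l)
    gs∈C : ∀ i → gs i ∈C
    gs∈C i with i Fin.≟ l
    ... | yes _ = f∈C
    ... | no _  = proj-∈C zero
    gs-l : gs l ≡ f
    gs-l with l Fin.≟ l
    ... | yes _  = refl
    ... | no l≢l = contradiction refl l≢l
    gs-cases : ∀ i → (i ≡ l × gs i ≡ f) ⊎ gs i ≡ proj zero
    gs-cases i with i Fin.≟ l
    ... | yes i≡l = inj₁ (i≡l , refl)
    ... | no _    = inj₂ refl
    source : ∀ h {g} → ¬ (ρ h ≡ 0ℚ) → h ⟦ gs ⟧ ≗ g → (g ≗ f × 0ℚ < ρ h) ⊎ g ≗ proj zero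
    source h {g} ρh≢0 e with i , h≗i ← onProj h ρh≢0 with gs-cases i
    ... | inj₁ (refl , gsᵢ≡f) =
      inj₁ ((λ xs → trans (gs≗ xs) (cong (_$ xs) gsᵢ≡f)) , <-respʳ-≡ (sym (combination-ext R h≗i)) 0<ρl)
      where
      gs≗ : g ≗ gs i
      gs≗ xs = trans (sym (e xs)) (trans (h≗i _) (proj-⟦⟧ i gs xs))
    ... | inj₂ gsᵢ≡e₁ = inj₂ λ xs → trans (gs≗ xs) (cong (_$ xs) gsᵢ≡e₁)
      where
      gs≗ : g ≗ gs i
      gs≗ xs = trans (sym (e xs)) (trans (h≗i _) (proj-⟦⟧ i gs xs))
    combined : Combination (ρ ⟪ gs ⟫)
    combined = combination-⟪⟫ R gs∈C
    negative′ : ∀ g → (ρ ⟪ gs ⟫) g < 0ℚ → g ≗ proj zero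
    negative′ g <0 with h , e , ρh<0 ← ⟪⟫-source<0 {gs = gs} ρ <0 with source h (<⇒≢ ρh<0) e
    ... | inj₁ (_ , 0<ρh) = contradiction ρh<0 (<-asym 0<ρh)
    ... | inj₂ g≗e₁       = g≗e₁
    ∈W′ : ρ ⟪ gs ⟫ ∈W
    ∈W′ = combination-∈W combined λ g <0 → zero , negative′ g <0
    positive-f : 0ℚ < (ρ ⟪ gs ⟫) f
    positive-f = ⟪⟫-pos {gs = gs} (combination-ext R) 0≤ρ (proj l)
      (λ xs → trans (proj-⟦⟧ l gs xs) (cong (_$ xs) gs-l)) 0<ρl
      where
      0≤ρ : ∀ h → h ⟦ gs ⟧ ≗ f → 0ℚ ≤ ρ h
      0≤ρ h e with ρ h ≟ℚ 0ℚ
      ... | yes ρh≡0 = ≤-reflexive (sym ρh≡0)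
      ... | no  ρh≢0 with source h ρh≢0 e
      ...   | inj₁ (_ , 0<ρh) = <⇒≤ 0<ρh
      ...   | inj₂ f≗e₁       = contradiction (zero , f≗e₁) ¬proj
    only-f : ∀ g → 0ℚ < (ρ ⟪ gs ⟫) g → g ≗ f
    only-f g 0<g with h , e , ρh≢0 ← ⟪⟫-source≢0 {gs = gs} ρ (0<⇒≢0 0<g) with source h ρh≢0 e
    ... | inj₁ (g≗f , _) = g≗f
    -- Negative values occur at e₁ only. If e₁ itself had positive weight, all values would be
    -- non-negative and the sum could not vanish.
    ... | inj₂ g≗e₁ = contradiction (combination-sum combined)
      (0<⇒≢0 (∑-pos (combination-ext combined) 0≤ g 0<g))
      where
      0≤ : ∀ g′ → 0ℚ ≤ (ρ ⟪ gs ⟫) g′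
      0≤ g′ = ≮⇒≥ λ <0 → <-asym 0<g (<-respˡ-≡
        (combination-ext combined λ xs → trans (negative′ g′ <0 xs) (sym (g≗e₁ xs))) <0)

-- Types of ternary operations and their superposition.

-- A type p ∷ q ∷ r ∷ [] records whether an operation takes the value x
-- (true) or y (false) at (x,x,y), (x,y,x) and (y,x,x).
Type₃ : Set
Type₃ = Vec Bool 3

projType : Fin 3 → Type₃
projType zero             = true  ∷ true  ∷ false ∷ []
projType (suc zero)       = true  ∷ false ∷ true  ∷ []
projType (suc (suc zero)) = false ∷ true  ∷ true  ∷ []

isConst : Type₃ → Bool
isConst (true  ∷ true  ∷ true  ∷ []) = true
isConst (false ∷ false ∷ false ∷ []) = true
isConst _                            = false

-- Values on the eight triples over {x,y}, with `true` for x. A triple containing y twice arises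
-- from one containing x twice by exchanging x and y, whence the negations.
apply : Type₃ → Bool → Bool → Bool → Bool
apply (p ∷ q ∷ r ∷ []) true  true  true  = true
apply (p ∷ q ∷ r ∷ []) true  true  false = p
apply (p ∷ q ∷ r ∷ []) true  false true  = q
apply (p ∷ q ∷ r ∷ []) false true  true  = r
apply (p ∷ q ∷ r ∷ []) false false true  = not p
apply (p ∷ q ∷ r ∷ []) false true  false = not q
apply (p ∷ q ∷ r ∷ []) true  false false = not r
apply (p ∷ q ∷ r ∷ []) false false false = false

compose : Type₃ → Type₃ → Type₃ → Type₃ → Type₃
compose s (p ∷ q ∷ r ∷ []) (p′ ∷ q′ ∷ r′ ∷ []) (p″ ∷ q″ ∷ r″ ∷ []) =
  apply s p p′ p″ ∷ apply s q q′ q″ ∷ apply s r r′ r″ ∷ []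

rotType : Type₃ → Type₃
rotType (p ∷ q ∷ r ∷ []) = q ∷ r ∷ p ∷ []

-- The rotations of a non-constant type take, at each of the three
-- positions, the values x, x, y or y, y, x in some order; so substituting
-- them permutes the entries of s, possibly after exchanging x and y.
isConst-compose : ∀ s t → isConst t ≡ false →
                  isConst (compose s t (rotType t) (rotType (rotType t))) ≡ isConst s
isConst-compose = from-yes
  (allVec? 3 λ s → allVec? 3 λ t → (isConst t ≟ᴮ false) →-dec
    (isConst (compose s t (rotType t) (rotType (rotType t))) ≟ᴮ isConst s))
  where open FiniteSet (↔-sym 2↔Bool)

isConst-rot : ∀ t → isConst (rotType t) ≡ isConst t
isConst-rot = from-yes (allVec? 3 λ t → isConst (rotType t) ≟ᴮ isConst t)
  where open FiniteSet (↔-sym 2↔Bool)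

module Ternary {D : Set a} where

  -- The types constantly `true` and constantly `false` unfold to `IsMajority` and `IsMinority`,
  -- which is used silently below.
  HasType : Op D 3 → Type₃ → Set a
  HasType f (p ∷ q ∷ r ∷ []) = ∀ x y →
    (f (x ∷ x ∷ y ∷ []) ≡ (if p then x else y)) ×
    (f (x ∷ y ∷ x ∷ []) ≡ (if q then x else y)) ×
    (f (y ∷ x ∷ x ∷ []) ≡ (if r then x else y))

  Typed : Op D 3 → Set a
  Typed f = ∃ (HasType f)

  HasType-resp : {f g : Op D 3} → f ≗ g → ∀ s → HasType f s → HasType g s
  HasType-resp f≗g (p ∷ q ∷ r ∷ []) h x y = let e₁ , e₂ , e₃ = h x y in
    trans (sym (f≗g _)) e₁ , trans (sym (f≗g _)) e₂ , trans (sym (f≗g _)) e₃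

  HasType-proj : ∀ i → HasType (proj i) (projType i)
  HasType-proj zero             x y = refl , refl , refl
  HasType-proj (suc zero)       x y = refl , refl , refl
  HasType-proj (suc (suc zero)) x y = refl , refl , refl

  private
    if-same : ∀ b {x : D} → (if b then x else x) ≡ x
    if-same true  = refl
    if-same false = refl

    if-not : ∀ b {x y : D} → (if b then y else x) ≡ (if not b then x else y)
    if-not true  = refl
    if-not false = refl

  apply-HasType : ∀ {f} s → HasType f s → ∀ b b′ b″ x y →
    f ((if b then x else y) ∷ (if b′ then x else y) ∷ (if b″ then x else y) ∷ []) ≡
    (if apply s b b′ b″ then x else y)
  apply-HasType (p ∷ q ∷ r ∷ []) h true  true  true  x y = trans (proj₁ (h x x)) (if-same p)
  apply-HasType (p ∷ q ∷ r ∷ []) h true  true  false x y = proj₁ (h x y)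
  apply-HasType (p ∷ q ∷ r ∷ []) h true  false true  x y = proj₁ (proj₂ (h x y))
  apply-HasType (p ∷ q ∷ r ∷ []) h false true  true  x y = proj₂ (proj₂ (h x y))
  apply-HasType (p ∷ q ∷ r ∷ []) h false false true  x y = trans (proj₁ (h y x)) (if-not p)
  apply-HasType (p ∷ q ∷ r ∷ []) h false true  false x y = trans (proj₁ (proj₂ (h y x))) (if-not q)
  apply-HasType (p ∷ q ∷ r ∷ []) h true  false false x y = trans (proj₂ (proj₂ (h y x))) (if-not r)
  apply-HasType (p ∷ q ∷ r ∷ []) h false false false x y = trans (proj₁ (h y y)) (if-same p)

  HasType-⟦⟧ : ∀ {f} {gs : Fin 3 → Op D 3} s t t′ t″ → HasType f s →
    HasType (gs zero) t → HasType (gs (suc zero)) t′ → HasType (gs (suc (suc zero))) t″ →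
    HasType (f ⟦ gs ⟧) (compose s t t′ t″)
  HasType-⟦⟧ {f} s (p ∷ q ∷ r ∷ []) (p′ ∷ q′ ∷ r′ ∷ []) (p″ ∷ q″ ∷ r″ ∷ []) hf h h′ h″ x y =
    at (proj₁ (h x y)) (proj₁ (h′ x y)) (proj₁ (h″ x y)) ,
    at (proj₁ (proj₂ (h x y))) (proj₁ (proj₂ (h′ x y))) (proj₁ (proj₂ (h″ x y))) ,
    at (proj₂ (proj₂ (h x y))) (proj₂ (proj₂ (h′ x y))) (proj₂ (proj₂ (h″ x y)))
    where
    at : ∀ {u u′ u″ b b′ b″} → u ≡ (if b then x else y) → u′ ≡ (if b′ then x else y) →
         u″ ≡ (if b″ then x else y) → f (u ∷ u′ ∷ u″ ∷ []) ≡ (if apply s b b′ b″ then x else y)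
    at {b = b} {b′} {b″} refl refl refl = apply-HasType s hf b b′ b″ x y

  rot : Op D 3 → Op D 3
  rot f (x ∷ y ∷ z ∷ []) = f (y ∷ z ∷ x ∷ [])

  rot-cong : {f g : Op D 3} → f ≗ g → rot f ≗ rot g
  rot-cong f≗g (x ∷ y ∷ z ∷ []) = f≗g _

  rot³ : (f : Op D 3) → rot (rot (rot f)) ≗ f
  rot³ f (x ∷ y ∷ z ∷ []) = refl

  HasType-rot : ∀ {f} s → HasType f s → HasType (rot f) (rotType s)
  HasType-rot (p ∷ q ∷ r ∷ []) h x y = let e₁ , e₂ , e₃ = h x y in e₂ , e₃ , e₁

  rotations : Op D 3 → Fin 3 → Op D 3
  rotations f zero             = f
  rotations f (suc zero)       = rot f
  rotations f (suc (suc zero)) = rot (rot f)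

  rot-⟦rotations⟧ : (f g : Op D 3) → rot (f ⟦ rotations g ⟧) ≗ f ⟦ rotations (rot g) ⟧
  rot-⟦rotations⟧ f g (x ∷ y ∷ z ∷ []) = refl

  Good : Op D 3 → Set a
  Good f = IsMajority f ⊎ IsMinority f

  IsMajority-resp : {f g : Op D 3} → f ≗ g → IsMajority f → IsMajority g
  IsMajority-resp f≗g = HasType-resp f≗g (true ∷ true ∷ true ∷ [])

  IsMinority-resp : {f g : Op D 3} → f ≗ g → IsMinority f → IsMinority g
  IsMinority-resp f≗g = HasType-resp f≗g (false ∷ false ∷ false ∷ [])

  Good-resp : {f g : Op D 3} → f ≗ g → Good f → Good g
  Good-resp f≗g (inj₁ h) = inj₁ (IsMajority-resp f≗g h)
  Good-resp f≗g (inj₂ h) = inj₂ (IsMinority-resp f≗g h)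

  isConst⇒Good : ∀ {f} s → HasType f s → isConst s ≡ true → Good f
  isConst⇒Good (true  ∷ true  ∷ true  ∷ []) h _ = inj₁ h
  isConst⇒Good (false ∷ false ∷ false ∷ []) h _ = inj₂ h

  module _ (_≟D_ : DecidableEquality D) where

    -- The three equations of a type cover every triple with two equal entries.
    HasType-agree : ∀ {f g} s → HasType f s → HasType g s → ∀ xs → ¬ Unique xs → f xs ≡ g xs
    HasType-agree (p ∷ q ∷ r ∷ []) hf hg (x ∷ y ∷ z ∷ []) ¬unique with x ≟D y | x ≟D z | y ≟D z
    ... | yes refl | _        | _        = trans (proj₁ (hf x z)) (sym (proj₁ (hg x z)))
    ... | no _     | yes refl | _        = trans (proj₁ (proj₂ (hf x y))) (sym (proj₁ (proj₂ (hg x y))))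
    ... | no _     | no _     | yes refl = trans (proj₂ (proj₂ (hf y x))) (sym (proj₂ (proj₂ (hg y x))))
    ... | no x≢y   | no x≢z   | no y≢z   =
      contradiction ((x≢y ∷ x≢z ∷ []) ∷ (y≢z ∷ []) ∷ [] ∷ []) ¬unique

    projType⇒semiprojection : ∀ {f} i → HasType f (projType i) → ¬ IsProjection f → IsSemiprojection f
    projType⇒semiprojection i h ¬proj = ¬proj , i , HasType-agree (projType i) h (HasType-proj i)

  module _ {x₀ x₁ : D} (x₀≢x₁ : ¬ (x₀ ≡ x₁)) where

    HasType-unique : ∀ {f} s t → HasType f s → HasType f t → s ≡ t
    HasType-unique (p ∷ q ∷ r ∷ []) (p′ ∷ q′ ∷ r′ ∷ []) h h′ =
      let e₁ , e₂ , e₃ = h x₀ x₁ ; e₁′ , e₂′ , e₃′ = h′ x₀ x₁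
      in cong₂ _∷_ (unique p p′ (trans (sym e₁) e₁′)) (cong₂ _∷_ (unique q q′ (trans (sym e₂) e₂′))
           (cong₂ _∷_ (unique r r′ (trans (sym e₃) e₃′)) refl))
      where
      unique : ∀ b b′ → (if b then x₀ else x₁) ≡ (if b′ then x₀ else x₁) → b ≡ b′
      unique true  true  e = refl
      unique true  false e = contradiction e x₀≢x₁
      unique false true  e = contradiction (sym e) x₀≢x₁
      unique false false e = refl

    Good⇒isConst : ∀ {f} s → HasType f s → Good f → isConst s ≡ true
    Good⇒isConst s h (inj₁ maj) = cong isConst (HasType-unique s (true ∷ true ∷ true ∷ []) h maj)
    Good⇒isConst s h (inj₂ min) = cong isConst (HasType-unique s (false ∷ false ∷ false ∷ []) h min)

    Good⇒¬projection : ∀ {f} → Good f → ¬ IsProjection f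
    Good⇒¬projection good (i , f≗i) =
      contradiction (trans (sym (nonconst i)) (Good⇒isConst (projType i) (HasType-proj i) (Good-resp f≗i good)))
                    λ ()
      where
      nonconst : ∀ i → isConst (projType i) ≡ false
      nonconst zero             = refl
      nonconst (suc zero)       = refl
      nonconst (suc (suc zero)) = refl

    ¬Good⇒¬isConst : ∀ {f} s → HasType f s → ¬ Good f → isConst s ≡ false
    ¬Good⇒¬isConst s h bad with isConst s in eq
    ... | true  = contradiction (isConst⇒Good s h eq) bad
    ... | false = refl

    majority∧minority : ∀ {f} → IsMajority f → ¬ IsMinority f
    majority∧minority {f} maj min =
      contradiction (HasType-unique {f} (true ∷ true ∷ true ∷ []) (false ∷ false ∷ false ∷ []) maj min) λ ()

  module _ (_≟D_ : DecidableEquality D) {x₀ x₁ : D} (x₀≢x₁ : ¬ (x₀ ≡ x₁)) where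

    open Minors _≟D_ x₀≢x₁

    -- Each identification of two variables returns some variable. The entry of the type records
    -- whether that variable holds x or y in the corresponding triple.
    typed-from-minors : (f : Op D 3) → HasMinors f → Typed f
    typed-from-minors f minors
      with s , acts ← minors {zero} {suc zero} (λ ())
      with t , acts′ ← minors {zero} {suc (suc zero)} (λ ())
      with u , acts″ ← minors {suc zero} {suc (suc zero)} (λ ()) =
      lookup (true ∷ true ∷ false ∷ []) s ∷ lookup (true ∷ false ∷ true ∷ []) t ∷
      lookup (false ∷ true ∷ true ∷ []) u ∷ [] ,
      λ x y → trans (acts _ refl) (first x y s) , trans (acts′ _ refl) (second x y t) , trans (acts″ _ refl) (third x y u)
      where
      first : ∀ (x y : D) s → lookup (x ∷ x ∷ y ∷ []) s ≡
              (if lookup (true ∷ true ∷ false ∷ []) s then x else y)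
      first x y zero             = refl
      first x y (suc zero)       = refl
      first x y (suc (suc zero)) = refl
      second : ∀ (x y : D) s → lookup (x ∷ y ∷ x ∷ []) s ≡ (if lookup (true ∷ false ∷ true ∷ []) s then x else y)
      second x y zero             = refl
      second x y (suc zero)       = refl
      second x y (suc (suc zero)) = refl
      third : ∀ (x y : D) s → lookup (y ∷ x ∷ x ∷ []) s ≡ (if lookup (false ∷ true ∷ true ∷ []) s then x else y)
      third x y zero             = refl
      third x y (suc zero)       = refl
      third x y (suc (suc zero)) = refl

-- Rules for bad operations and their elimination.

module Elimination {D : Set a} {n : ℕ} (D↔Fin : D ↔ Fin n) {x₀ x₁ : D} (x₀≢x₁ : ¬ (x₀ ≡ x₁))
                   (W : WeightedClone D↔Fin c w) where

  open FiniteSet D↔Fin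
  open Operations D↔Fin
  open WeightedClone W
  open IsWeighting
  open Ternary {D = D}
  open Combinations D↔Fin W

  good? : Decidable Good
  good? f = isMajority? f ⊎-dec isMinority? f

  opaque
    goodness badness : Weight D 3
    goodness f = [ good? f ] 1ℚ
    badness  f = [ ¬? (good? f) ] 1ℚ

    0≤badness : ∀ f → 0ℚ ≤ badness f
    0≤badness f = []-nonneg (¬? (good? f)) λ _ → nonNegative⁻¹ 1ℚ

    goodness-ext : Extensional goodness
    goodness-ext {f} {g} f≗g =
      []-cong (good? f) (good? g) (Good-resp {f} {g} f≗g) (Good-resp {g} {f} (sym ∘ f≗g)) 1ℚ

    badness-cong : ∀ f g → (Good f → Good g) → (Good g → Good f) → badness f ≡ badness g
    badness-cong f g to from = []-cong (¬? (good? f)) (¬? (good? g)) (_∘ from) (_∘ to) 1ℚ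

    []-goodness : ∀ f x → [ good? f ] x ≡ x * goodness f
    []-goodness f x = []-one (good? f) x

    badness+goodness : ∀ f x → x * badness f + x * goodness f ≡ x
    badness+goodness f x = total (good? f)
      where
      total : (d : Dec (Good f)) → x * [ ¬? d ] 1ℚ + x * [ d ] 1ℚ ≡ x
      total (yes _) = trans (cong₂ _+_ (*-zeroʳ x) (*-identityʳ x)) (+-identityˡ x)
      total (no _)  = trans (cong₂ _+_ (*-identityʳ x) (*-zeroʳ x)) (+-identityʳ x)

  badness-ext : Extensional badness
  badness-ext {f} {g} f≗g = badness-cong f g (Good-resp {f} {g} f≗g) (Good-resp {g} {f} (sym ∘ f≗g))

  badness-type : ∀ f g s t → HasType f s → HasType g t → isConst s ≡ isConst t → badness f ≡ badness g
  badness-type f g s t hf hg e = badness-cong f g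
    (λ good → isConst⇒Good {f = g} t hg (trans (sym e) (Good⇒isConst x₀≢x₁ {f} s hf good)))
    (λ good → isConst⇒Good {f = f} s hf (trans e (Good⇒isConst x₀≢x₁ {g} t hg good)))

  badWeight : Weight D 3 → ℚ
  badWeight ρ = ∑ λ f → ρ f * badness f

  badWeight-+ : (ρ σ : Weight D 3) → badWeight (λ f → ρ f + σ f) ≡ badWeight ρ + badWeight σ
  badWeight-+ ρ σ = trans (∑-cong λ f → *-distribʳ-+ (badness f) (ρ f) (σ f))
                          (∑-+ (λ f → ρ f * badness f) (λ f → σ f * badness f))

  badWeight-* : ∀ x (ρ : Weight D 3) → badWeight (λ f → x * ρ f) ≡ x * badWeight ρ
  badWeight-* x ρ = trans (∑-cong λ f → *-assoc x (ρ f) (badness f)) (∑-* x λ f → ρ f * badness f)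

  Orbit : Op D 3 → Op D 3 → Set a
  Orbit b f = ∃ λ i → f ≗ rotations b i

  orbit? : ∀ b → Decidable (Orbit b)
  orbit? b f = Fin.any? λ i → f ≗? rotations b i

  -- A rule for b exchanges weight on the orbit of b for weight on other
  -- operations; since its bad weight is negative, some of the latter are good.
  record Rule (b : Op D 3) (done : List (Op D 3)) (ρ : Weight D 3) : Set (a ⊔ c ⊔ w) where
    field
      combination : Combination ρ
      rot-inv     : ∀ f → ρ (rot f) ≡ ρ f
      typed       : ∀ f → ¬ (ρ f ≡ 0ℚ) → Typed f
      off-orbit   : ∀ f → ¬ Orbit b f → 0ℚ ≤ ρ f
      bad-weight  : badWeight ρ < 0ℚ
      eliminated  : All (λ t → ¬ Good t → ¬ Orbit b t → ρ t ≡ 0ℚ) done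

    ext : Extensional ρ
    ext = combination-ext combination

    orbit-inv : ∀ {g f} → Orbit g f → ρ f ≡ ρ g
    orbit-inv (zero , e)               = ext e
    orbit-inv {g} (suc zero , e)       = trans (ext e) (rot-inv g)
    orbit-inv {g} (suc (suc zero) , e) = trans (ext e) (trans (rot-inv (rot g)) (rot-inv g))

    -- Otherwise `ρ` would be non-negative on the orbit of `b`, hence everywhere, and so would be
    -- its bad weight.
    ρb<0 : ρ b < 0ℚ
    ρb<0 = ≰⇒> λ 0≤ρb → <⇒≱ bad-weight (∑-nonneg λ f → 0≤* (0≤ρ 0≤ρb f) (0≤badness f))
      where
      0≤ρ : 0ℚ ≤ ρ b → ∀ f → 0ℚ ≤ ρ f
      0≤ρ 0≤ρb f with orbit? b f
      ... | yes f∈b = ≤-trans 0≤ρb (≤-reflexive (sym (orbit-inv f∈b)))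
      ... | no  f∉b = off-orbit f f∉b

  open Rule

  Rules : List (Op D 3) → Set (a ⊔ c ⊔ w)
  Rules done = ∀ b → b ∈C → Typed b → ¬ Good b → ∃ (Rule b done)

  -- This is a step of Gaussian elimination: the positive weight that the
  -- rule ρ of b has on the orbit of t is cancelled by the rule σ of t.
  cancel : ∀ {b t done ρ σ} → ¬ Orbit b t → Rule b done ρ → Rule t done σ →
           Rule b (t ∷ done) (λ f → (- σ t) * ρ f + ρ t * σ f)
  cancel {b} {t} {done} {ρ} {σ} t∉b R S = record
    { combination = combination-+ (combination-* (combination R) (<⇒≤ 0<-σt))
                                  (combination-* (combination S) 0≤ρt)
    ; rot-inv     = λ f → cong₂ (λ x y → (- σ t) * x + ρ t * y) (rot-inv R f) (rot-inv S f)
    ; typed       = typed′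
    ; off-orbit   = off-orbit′
    ; bad-weight  = bad-weight′
    ; eliminated  = (λ _ _ → orbit-zero (zero , λ _ → refl)) ∷ All.zipWith later (eliminated R , eliminated S)
    }
    where
    0<-σt : 0ℚ < - σ t
    0<-σt = neg-antimono-< (ρb<0 S)
    0≤ρt : 0ℚ ≤ ρ t
    0≤ρt = off-orbit R t t∉b
    both-zero : ∀ {x y} → x ≡ 0ℚ → y ≡ 0ℚ → (- σ t) * x + ρ t * y ≡ 0ℚ
    both-zero refl refl = cong₂ _+_ (*-zeroʳ (- σ t)) (*-zeroʳ (ρ t))
    orbit-zero : ∀ {f} → Orbit t f → (- σ t) * ρ f + ρ t * σ f ≡ 0ℚ
    orbit-zero {f} f∈t = begin
      (- σ t) * ρ f + ρ t * σ f  ≡⟨ cong₂ (λ x y → (- σ t) * x + ρ t * y) (orbit-inv R f∈t) (orbit-inv S f∈t) ⟩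
      (- σ t) * ρ t + ρ t * σ t  ≡⟨ cong₂ _+_ (sym (neg-distribˡ-* (σ t) (ρ t))) (*-comm (ρ t) (σ t)) ⟩
      - (σ t * ρ t) + σ t * ρ t  ≡⟨ +-inverseˡ (σ t * ρ t) ⟩
      0ℚ                         ∎
      where open ≡-Reasoning
    typed′ : ∀ f → ¬ ((- σ t) * ρ f + ρ t * σ f ≡ 0ℚ) → Typed f
    typed′ f ≢0 with ρ f ≟ℚ 0ℚ | σ f ≟ℚ 0ℚ
    ... | no ρf≢0  | _        = typed R f ρf≢0
    ... | yes _    | no σf≢0  = typed S f σf≢0
    ... | yes ρf≡0 | yes σf≡0 = contradiction (both-zero ρf≡0 σf≡0) ≢0
    off-orbit′ : ∀ f → ¬ Orbit b f → 0ℚ ≤ (- σ t) * ρ f + ρ t * σ f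
    off-orbit′ f f∉b with orbit? t f
    -- The orbit of `t` is the only place where `σ` may be negative, and there the combination
    -- vanishes.
    ... | yes f∈t = ≤-reflexive (sym (orbit-zero f∈t))
    ... | no  f∉t = +-mono-≤ (0≤* (<⇒≤ 0<-σt) (off-orbit R f f∉b)) (0≤* 0≤ρt (off-orbit S f f∉t))
    bad-weight′ : badWeight (λ f → (- σ t) * ρ f + ρ t * σ f) < 0ℚ
    bad-weight′ = <-respˡ-≡
      (sym (trans (badWeight-+ (λ f → (- σ t) * ρ f) (λ f → ρ t * σ f))
                  (cong₂ _+_ (badWeight-* (- σ t) ρ) (badWeight-* (ρ t) σ))))
      (+-mono-<-≤
        (subst ((- σ t) * badWeight ρ <_) (*-zeroʳ (- σ t))
               (*-monoʳ-<-pos (- σ t) ⦃ positive 0<-σt ⦄ (bad-weight R)))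
        (subst (ρ t * badWeight σ ≤_) (*-zeroʳ (ρ t))
               (*-monoˡ-≤-nonNeg (ρ t) ⦃ nonNegative 0≤ρt ⦄ (<⇒≤ (bad-weight S)))))
    later : ∀ {u} → (¬ Good u → ¬ Orbit b u → ρ u ≡ 0ℚ) × (¬ Good u → ¬ Orbit t u → σ u ≡ 0ℚ) →
            ¬ Good u → ¬ Orbit b u → (- σ t) * ρ u + ρ t * σ u ≡ 0ℚ
    later {u} (ρ-done , σ-done) bad u∉b with orbit? t u
    ... | yes u∈t = orbit-zero u∈t
    ... | no  u∉t = both-zero (ρ-done bad u∉b) (σ-done bad u∉t)

  extend : ∀ {b t done ρ} → Rule b done ρ → (¬ Good t → ¬ Orbit b t → ρ t ≡ 0ℚ) → Rule b (t ∷ done) ρ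
  extend R h = record
    { combination = combination R
    ; rot-inv     = rot-inv R
    ; typed       = typed R
    ; off-orbit   = off-orbit R
    ; bad-weight  = bad-weight R
    ; eliminated  = h ∷ eliminated R
    }

  -- If `ρ` has weight at `t`, then `t` lies in the clone and is typed, so it has a rule of its own.
  -- Off their own orbits both rules avoid the bad operations in `done`, and the combination
  -- vanishes on the orbit of `t`, so cancelling brings none of them back off the orbit of `b`.
  eliminate : ∀ {done} t → Rules done → Rules (t ∷ done)
  eliminate {done} t rules b b∈C b-typed b-bad = by-cases (rules b b∈C b-typed b-bad)
    where
    by-cases : ∃ (Rule b done) → ∃ (Rule b (t ∷ done))
    by-cases (ρ , R) = decide (orbit? b t) (good? t) (ρ t ≟ℚ 0ℚ)
      where
      decide : Dec (Orbit b t) → Dec (Good t) → Dec (ρ t ≡ 0ℚ) → ∃ (Rule b (t ∷ done))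
      decide (yes t∈b) _ _           = ρ , extend R λ _ t∉b → contradiction t∈b t∉b
      decide (no _) (yes good) _     = ρ , extend R λ bad → contradiction good bad
      decide (no _) (no _) (yes ≡0)  = ρ , extend R λ _ _ → ≡0
      decide (no t∉b) (no bad) (no ≢0) =
        let σ , S = rules t (combination-≢0⇒∈C (combination R) t ≢0) (typed R t ≢0) bad
        in _ , cancel t∉b R S

  eliminate-all : Rules [] → ∀ ts → Rules ts
  eliminate-all rules []       = rules
  eliminate-all rules (t ∷ ts) = eliminate t (eliminate-all rules ts)

  eliminated-all : ∀ {b ρ} → Rule b (List.tabulate op) ρ → ∀ f → ¬ Good f → ¬ Orbit b f → ρ f ≡ 0ℚ
  eliminated-all {b} {ρ} R f bad f∉b = trans (sym (ext R (op-opCode f)))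
    (tabulate⁻ (eliminated R) (opCode f) (bad ∘ Good-resp {op (opCode f)} {f} (op-opCode f))
      λ (i , e) → f∉b (i , λ xs → trans (sym (op-opCode f xs)) (e xs)))

  module _ {ω : Weight D 3} (ω∈W : ω ∈W) (ω-typed : ∀ f → ¬ (ω f ≡ 0ℚ) → Typed f)
           {g : Op D 3} (g-good : Good g) (0<ωg : 0ℚ < ω g) where

    Good⇒0≤ω : ∀ f → Good f → 0ℚ ≤ ω f
    Good⇒0≤ω f good = ≮⇒≥ λ ωf<0 → Good⇒¬projection x₀≢x₁ {f} good (negative (isWeighting ω∈W) f ωf<0)

    -- The good weight is positive, because good operations are not projections and `g` contributes.
    -- Good and bad weight sum to zero.
    badWeight-ω<0 : badWeight ω < 0ℚ
    badWeight-ω<0 = subst₂ _<_ (+-identityʳ (badWeight ω)) split (+-monoʳ-< (badWeight ω) 0<goodWeight)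
      where
      0<goodWeight : 0ℚ < ∑ λ f → ω f * goodness f
      0<goodWeight = ∑-pos (λ e → cong₂ _*_ (∈W-ext ω∈W e) (goodness-ext e)) 0≤ g
        (<-respʳ-≡ (trans (sym ([]-yes (good? g) g-good (ω g))) ([]-goodness g (ω g))) 0<ωg)
        where
        0≤ : ∀ f → 0ℚ ≤ ω f * goodness f
        0≤ f = subst (0ℚ ≤_) ([]-goodness f (ω f)) ([]-nonneg (good? f) (Good⇒0≤ω f))
      split : badWeight ω + ∑ (λ f → ω f * goodness f) ≡ 0ℚ
      split = trans (sym (∑-+ (λ f → ω f * badness f) (λ f → ω f * goodness f)))
                (trans (∑-cong λ f → badness+goodness f (ω f)) (∈W-sum ω∈W))

    module _ {b : Op D 3} (b∈C : b ∈C) (s : Type₃) (b-type : HasType b s) (s-nonconst : isConst s ≡ false) where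

      private
        rotations-type : ∀ h t → HasType h t →
          HasType (h ⟦ rotations b ⟧) (compose t s (rotType s) (rotType (rotType s)))
        rotations-type h t h-type = HasType-⟦⟧ {f = h} {gs = rotations b} t s (rotType s) (rotType (rotType s))
          h-type b-type (HasType-rot {b} s b-type) (HasType-rot {rot b} (rotType s) (HasType-rot {b} s b-type))

      rotations-typed : ∀ f → ¬ ((ω ⟪ rotations b ⟫) f ≡ 0ℚ) → Typed f
      rotations-typed f ≢0 =
        let h , e , ωh≢0 = ⟪⟫-source≢0 {gs = rotations b} ω {f} ≢0
            t , h-type = ω-typed h ωh≢0
        in _ , HasType-resp {h ⟦ rotations b ⟧} {f} e _ (rotations-type h t h-type)

      rotations-off-orbit : ∀ f → ¬ Orbit b f → 0ℚ ≤ (ω ⟪ rotations b ⟫) f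
      rotations-off-orbit f f∉b = ≮⇒≥ λ <0 →
        let h , e , ωh<0 = ⟪⟫-source<0 {gs = rotations b} ω {f} <0
            i , h≗i = negative (isWeighting ω∈W) h ωh<0
        in f∉b (i , λ xs → trans (sym (e xs)) (trans (h≗i _) (proj-⟦⟧ i (rotations b) xs)))

      -- By `isConst-compose`, substituting the rotations of `b` keeps good operations good and
      -- other typed operations bad.
      rotations-badWeight : badWeight (ω ⟪ rotations b ⟫) ≡ badWeight ω
      rotations-badWeight = trans (⟪⟫-pairing {gs = rotations b} ω badness-ext) (∑-cong same)
        where
        same : ∀ f → ω f * badness (f ⟦ rotations b ⟧) ≡ ω f * badness f
        same f = decide (ω f ≟ℚ 0ℚ)
          where
          zero-* : ∀ {x} y z → x ≡ 0ℚ → x * y ≡ x * z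
          zero-* y z refl = trans (*-zeroˡ y) (sym (*-zeroˡ z))
          decide : Dec (ω f ≡ 0ℚ) → ω f * badness (f ⟦ rotations b ⟧) ≡ ω f * badness f
          decide (yes ωf≡0) = zero-* (badness (f ⟦ rotations b ⟧)) (badness f) ωf≡0
          decide (no ωf≢0)  = let t , f-type = ω-typed f ωf≢0 in cong (ω f *_)
            (badness-type (f ⟦ rotations b ⟧) f _ t (rotations-type f t f-type) f-type (isConst-compose t s s-nonconst))

    private
      rotated : Op D 3 → Weight D 3
      rotated b = ω ⟪ rotations b ⟫

      rotated-rot : ∀ b f → rotated (rot b) (rot f) ≡ rotated b f
      rotated-rot b f = ⟪⟫-match {gs = rotations (rot b)} {hs = rotations b} ω
        (λ h e xs → rot-injective (λ ys → trans (rot-⟦rotations⟧ h b ys) (e ys)) xs)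
        (λ h e xs → trans (sym (rot-⟦rotations⟧ h b xs)) (rot-cong e xs))
        where
        rot-injective : {f g : Op D 3} → rot f ≗ rot g → f ≗ g
        rot-injective e (x ∷ y ∷ z ∷ []) = e (z ∷ x ∷ y ∷ [])

      rotated³ : ∀ b f → rotated (rot (rot (rot b))) f ≡ rotated b f
      rotated³ b f = ⟪⟫-congʳ ω {rotations (rot (rot (rot b)))} {rotations b}
        (λ { zero → rot³ b ; (suc zero) → rot-cong (rot³ b)
           ; (suc (suc zero)) → rot-cong (rot-cong (rot³ b)) }) f

    -- Substituting the rotations of `b` moves the negative weight from the projections to the orbit
    -- of `b` and preserves the bad weight. Adding the results for `b`, `rot b` and `rot (rot b)`
    -- makes the weight invariant under rotation.
    initial-rules : Rules []
    initial-rules b b∈C (s , b-type) bad = ρ , record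
      { combination = combination-+ (rotated-combination b∈C)
          (combination-+ (rotated-combination rb∈C) (rotated-combination (rot-∈C rb∈C)))
      ; rot-inv     = rot-inv′
      ; typed       = typed′
      ; off-orbit   = λ f f∉b → +-mono-≤ (rotations-off-orbit b∈C s b-type s-nonconst f f∉b)
          (+-mono-≤ (rotations-off-orbit rb∈C rs rb-type rs-nonconst f (f∉b ∘ unrot))
                    (rotations-off-orbit (rot-∈C rb∈C) rrs rrb-type rrs-nonconst f (f∉b ∘ unrot ∘ unrot)))
      ; bad-weight  = bad-weight′
      ; eliminated  = []
      }
      where
      ρ : Weight D 3
      ρ f = rotated b f + (rotated (rot b) f + rotated (rot (rot b)) f)
      rot-∈C : ∀ {f} → f ∈C → rot f ∈C
      rot-∈C {f} f∈C = ∈C-resp-≗ {f = f ⟦ gs ⟧} (λ { (x ∷ y ∷ z ∷ []) → refl }) (superpose-∈C f∈C gs∈C)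
        where
        gs : Fin 3 → Op D 3
        gs = proj ∘ lookup (suc zero ∷ suc (suc zero) ∷ zero ∷ [])
        gs∈C : ∀ i → gs i ∈C
        gs∈C i = proj-∈C _
      rotated-combination : ∀ {b} → b ∈C → Combination (rotated b)
      rotated-combination b∈C = combination-⟪⟫ (∈W⇒combination ω∈W)
        λ { zero → b∈C ; (suc zero) → rot-∈C b∈C ; (suc (suc zero)) → rot-∈C (rot-∈C b∈C) }
      rs rrs : Type₃
      rs = rotType s
      rrs = rotType rs
      rb∈C : rot b ∈C
      rb∈C = rot-∈C b∈C
      s-nonconst : isConst s ≡ false
      s-nonconst = ¬Good⇒¬isConst x₀≢x₁ {b} s b-type bad
      rs-nonconst : isConst rs ≡ false
      rs-nonconst = trans (isConst-rot s) s-nonconst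
      rrs-nonconst : isConst rrs ≡ false
      rrs-nonconst = trans (isConst-rot rs) rs-nonconst
      rb-type : HasType (rot b) rs
      rb-type = HasType-rot {b} s b-type
      rrb-type : HasType (rot (rot b)) rrs
      rrb-type = HasType-rot {rot b} rs rb-type
      unrot : ∀ {b f} → Orbit (rot b) f → Orbit b f
      unrot (zero , e)               = suc zero , e
      unrot (suc zero , e)           = suc (suc zero) , e
      unrot {b} (suc (suc zero) , e) = zero , λ xs → trans (e xs) (rot³ b xs)
      rot-inv′ : ∀ f → ρ (rot f) ≡ ρ f
      rot-inv′ f = begin
        rotated b (rot f) + (rotated (rot b) (rot f) + rotated (rot (rot b)) (rot f))
          ≡⟨ cong₂ _+_ (trans (sym (rotated³ b (rot f))) (rotated-rot (rot (rot b)) f))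
                       (cong₂ _+_ (rotated-rot b f) (rotated-rot (rot b) f)) ⟩
        rotated (rot (rot b)) f + (rotated b f + rotated (rot b) f)
          ≡⟨ +-comm (rotated (rot (rot b)) f) _ ⟩
        (rotated b f + rotated (rot b) f) + rotated (rot (rot b)) f
          ≡⟨ +-assoc (rotated b f) _ _ ⟩
        ρ f ∎
        where open ≡-Reasoning
      typed′ : ∀ f → ¬ (ρ f ≡ 0ℚ) → Typed f
      typed′ f ≢0 = decide (rotated b f ≟ℚ 0ℚ) (rotated (rot b) f ≟ℚ 0ℚ) (rotated (rot (rot b)) f ≟ℚ 0ℚ)
        where
        decide : Dec (rotated b f ≡ 0ℚ) → Dec (rotated (rot b) f ≡ 0ℚ) → Dec (rotated (rot (rot b)) f ≡ 0ℚ) →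
                 Typed f
        decide (no h)   _        _        = rotations-typed b∈C s b-type s-nonconst f h
        decide (yes _)  (no h)   _        = rotations-typed rb∈C rs rb-type rs-nonconst f h
        decide (yes _)  (yes _)  (no h)   = rotations-typed (rot-∈C rb∈C) rrs rrb-type rrs-nonconst f h
        decide (yes e₁) (yes e₂) (yes e₃) = contradiction (cong₂ _+_ e₁ (cong₂ _+_ e₂ e₃)) ≢0
      bad-weight′ : badWeight ρ < 0ℚ
      bad-weight′ = <-respˡ-≡ (sym (begin
        badWeight ρ
          ≡⟨ badWeight-+ (rotated b) (λ f → rotated (rot b) f + rotated (rot (rot b)) f) ⟩
        badWeight (rotated b) + badWeight (λ f → rotated (rot b) f + rotated (rot (rot b)) f)
          ≡⟨ cong₂ _+_ (rotations-badWeight b∈C s b-type s-nonconst)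
               (trans (badWeight-+ (rotated (rot b)) (rotated (rot (rot b))))
                 (cong₂ _+_ (rotations-badWeight rb∈C rs rb-type rs-nonconst)
                            (rotations-badWeight (rot-∈C rb∈C) rrs rrb-type rrs-nonconst))) ⟩
        badWeight ω + (badWeight ω + badWeight ω) ∎))
        (+-mono-< badWeight-ω<0 (+-mono-< badWeight-ω<0 badWeight-ω<0))
        where open ≡-Reasoning

anyMap? : {P : Pred (Fin k → Fin m) p} → Decidable P → (∀ {f g} → f ≗ g → P f → P g) → Dec (∃ P)
anyMap? P? resp = map′ (λ (i , h) → finToFun i , h)
                       (λ (f , h) → funToFin f , resp (sym ∘ finToFun-funToFin f) h)
                       (Fin.any? (P? ∘ finToFun))

-- Minors of weightings in the rigid core.

module Proof {D : Set a} {n : ℕ} (D↔Fin : D ↔ Fin n) {x₀ x₁ : D} (x₀≢x₁ : ¬ (x₀ ≡ x₁))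
             (W : WeightedClone D↔Fin c w) (rigid : IsRigidCore D↔Fin W) where

  open FiniteSet D↔Fin
  open Operations D↔Fin
  open WeightedClone W
  open IsWeighting
  open Combinations D↔Fin W
  open Ternary {D = D}
  open Elimination D↔Fin x₀≢x₁ W
  open Minors _≟_ x₀≢x₁

  Conclusion : Set (a ⊔ w)
  Conclusion = ∃ λ k → ∃ λ (ω : Weight D k) →
    ω ∈W × (∃ λ f → f ∈supp ω) × HasListedSupport D↔Fin ω

  module _ {ω : Weight D k} (ω∈W : ω ∈W) where

    supp⇒∈C : ∀ {f} → f ∈supp ω → f ∈C
    supp⇒∈C {f} 0<ωf = vanishes (isWeighting ω∈W) f (0<⇒≢0 0<ωf)

    ¬projection⇒0≤ : ∀ f → ¬ IsProjection f → 0ℚ ≤ ω f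
    ¬projection⇒0≤ f ¬proj = ≮⇒≥ (¬proj ∘ negative (isWeighting ω∈W) f)

    relabelled-projection : ∀ {f i} (π : Fin k → Fin m) → f ≗ proj i → f ⟦ proj ∘ π ⟧ ≗ proj (π i)
    relabelled-projection {i = i} π f≗i xs = trans (f≗i _) (proj-⟦⟧ i (proj ∘ π) xs)

    -- A non-projection with non-zero weight has positive weight. If its minor were not a
    -- projection, no projection could be mapped there, so nothing would cancel that weight.
    minor-projection : (π : Fin k → Fin m) → (∀ g → ¬ ((ω ⟪ proj ∘ π ⟫) g ≡ 0ℚ) → IsProjection g) →
                       ∀ f → ¬ (ω f ≡ 0ℚ) → IsProjection (f ⟦ proj ∘ π ⟧)
    minor-projection π onProj f ωf≢0 with isProjection? f
    ... | yes (i , f≗i) = π i , relabelled-projection {f = f} π f≗i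
    ... | no ¬proj = decidable-stable (isProjection? (f ⟦ proj ∘ π ⟧)) λ ¬proj′ →
      ¬proj′ (onProj (f ⟦ proj ∘ π ⟧) (0<⇒≢0 (⟪⟫-pos (∈W-ext ω∈W)
        (λ h e → ¬projection⇒0≤ h λ (i , h≗i) →
          ¬proj′ (π i , λ xs → trans (sym (e xs)) (relabelled-projection {f = h} π h≗i xs)))
        f (λ _ → refl) (≤∧≢⇒< (¬projection⇒0≤ f ¬proj) (ωf≢0 ∘ sym)))))

    -- When `π` merges `i` with no other variable, the only projection mapped to `proj (π i)` is
    -- `proj i`. A positive weight there would survive in the minor.
    isolated-projection≤0 : (π : Fin k → Fin m) → (∀ g → (ω ⟪ proj ∘ π ⟫) g ≡ 0ℚ) →
                            ∀ i → (∀ j → π j ≡ π i → j ≡ i) → ω (proj i) ≤ 0ℚ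
    isolated-projection≤0 π ≡0 i isolated = ≮⇒≥ λ 0<ωi →
      0<⇒≢0 (⟪⟫-pos (∈W-ext ω∈W) (0≤ω 0<ωi) (proj i) (proj-⟦⟧ i (proj ∘ π)) 0<ωi) (≡0 (proj (π i)))
      where
      0≤ω : 0ℚ < ω (proj i) → ∀ h → h ⟦ proj ∘ π ⟧ ≗ proj (π i) → 0ℚ ≤ ω h
      0≤ω 0<ωi h e = ≮⇒≥ λ ωh<0 →
        let j , h≗j = negative (isWeighting ω∈W) h ωh<0
            j≡i = isolated j (proj-injective λ xs →
                    trans (sym (relabelled-projection {f = h} π h≗j xs)) (e xs))
        in <-asym 0<ωi (<-respˡ-≡ (∈W-ext ω∈W λ xs → trans (h≗j xs) (cong (lookup xs) j≡i)) ωh<0)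

    -- If one projection had positive weight, all would, leaving no negative weight to make the sum
    -- zero.
    balanced⇒¬projection : (∀ i j → ω (proj i) ≡ ω (proj j)) → ∀ f → f ∈supp ω → ¬ IsProjection f
    balanced⇒¬projection balanced f 0<ωf (i , f≗i) =
      0<⇒≢0 (∑-pos (∈W-ext ω∈W) 0≤ω f 0<ωf) (∈W-sum ω∈W)
      where
      0≤ω : ∀ g → 0ℚ ≤ ω g
      0≤ω g = ≮⇒≥ λ ωg<0 →
        let j , g≗j = negative (isWeighting ω∈W) g ωg<0
        in <-asym 0<ωf (<-respˡ-≡ (trans (∈W-ext ω∈W g≗j) (trans (balanced j i) (∈W-ext ω∈W (sym ∘ f≗i)))) ωg<0)

  -- Identifying all variables gives a unary operation of the clone, which rigidity makes the
  -- identity.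
  ∈C⇒idempotent : {f : Op D k} → f ∈C → IsIdempotent f
  ∈C⇒idempotent {k} {f} f∈C x = trans (cong f (replicate≡tabulate k))
    (rigid (f ⟦ (λ _ → proj zero) ⟧) (superpose-∈C f∈C λ _ → proj-∈C zero) (x ∷ []))
    where
    replicate≡tabulate : ∀ k → replicate k x ≡ tabulate λ (_ : Fin k) → x
    replicate≡tabulate zero    = refl
    replicate≡tabulate (suc k) = cong (x ∷_) (replicate≡tabulate k)

  nullary-empty : (f : Op D 0) → ¬ (f ∈C)
  nullary-empty f f∈C = x₀≢x₁ (trans (sym (∈C⇒idempotent f∈C x₀)) (∈C⇒idempotent f∈C x₁))

  -- Binary weightings.

  module _ {ω : Weight D 2} (ω∈W : ω ∈W) where

    private
      swap : Fin 2 → Fin 2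
      swap = lookup (suc zero ∷ zero ∷ [])

      -- Adding the copy with exchanged variables gives both projections the same weight, so neither
      -- can be in the support.
      symmetrized : Weight D 2
      symmetrized f = ω f + (ω ⟪ proj ∘ swap ⟫) f

      symmetrized∈W : symmetrized ∈W
      symmetrized∈W = +-∈W ω∈W (relabel-∈W ω∈W swap)

      swapped : ∀ i → (ω ⟪ proj ∘ swap ⟫) (proj i) ≡ ω (proj (swap i))
      swapped i = trans
        (⟪⟫-match {gs = proj ∘ swap} {hs = proj} ω (to i) (from i))
        (⟪proj⟫ (∈W-ext ω∈W) (proj (swap i)))
        where
        to : ∀ i f → f ⟦ proj ∘ swap ⟧ ≗ proj i → f ⟦ proj ⟧ ≗ proj (swap i)
        to zero       f e (x ∷ y ∷ []) = e (y ∷ x ∷ [])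
        to (suc zero) f e (x ∷ y ∷ []) = e (y ∷ x ∷ [])
        from : ∀ i f → f ⟦ proj ⟧ ≗ proj (swap i) → f ⟦ proj ∘ swap ⟧ ≗ proj i
        from zero       f e (x ∷ y ∷ []) = e (y ∷ x ∷ [])
        from (suc zero) f e (x ∷ y ∷ []) = e (y ∷ x ∷ [])

      first≡second : symmetrized (proj zero) ≡ symmetrized (proj (suc zero))
      first≡second = trans (cong (ω (proj zero) +_) (swapped zero))
        (trans (+-comm (ω (proj zero)) (ω (proj (suc zero))))
               (cong (ω (proj (suc zero)) +_) (sym (swapped (suc zero)))))

      balanced : ∀ i j → symmetrized (proj i) ≡ symmetrized (proj j)
      balanced zero       zero       = refl
      balanced zero       (suc zero) = first≡second
      balanced (suc zero) zero       = sym first≡second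
      balanced (suc zero) (suc zero) = refl

    binary-case : IsPositive ω → Conclusion
    binary-case (f , ¬proj , 0<ωf) = 2 , symmetrized , symmetrized∈W ,
      (f , +-mono-<-≤ 0<ωf (¬projection⇒0≤ (relabel-∈W ω∈W swap) f ¬proj)) ,
      binary λ g 0<g → ∈C⇒idempotent (supp⇒∈C symmetrized∈W 0<g) ,
                       balanced⇒¬projection symmetrized∈W balanced g 0<g

  -- Vanishing minors, and weightings of arity at least 4.

  IsSemiprojection-resp : {f g : Op D k} → f ≗ g → IsSemiprojection f → IsSemiprojection g
  IsSemiprojection-resp f≗g (¬proj , i , acts) =
    (λ (j , g≗j) → ¬proj (j , λ xs → trans (f≗g xs) (g≗j xs))) ,
    i , λ xs ¬unique → trans (sym (f≗g xs)) (acts xs ¬unique)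

  OnProjections : Weight D k → Set a
  OnProjections ω = ∀ g → ¬ (ω g ≡ 0ℚ) → IsProjection g

  module _ {m} {ω : Weight D (3 ℕ.+ m)} (ω∈W : ω ∈W) where

    -- Arity at least 3 leaves two variables `j` and `l` other than `i`. Merging them isolates `i`.
    zero-minors⇒¬projection : (∀ (π : Fin (3 ℕ.+ m) → Fin (2 ℕ.+ m)) g → (ω ⟪ proj ∘ π ⟫) g ≡ 0ℚ) →
                              ∀ f → f ∈supp ω → ¬ IsProjection f
    zero-minors⇒¬projection ≡0 f 0<ωf (i , f≗i) =
      let j , j∉ = fresh (ℕ.s≤s (ℕ.s≤s ℕ.z≤n)) (i ∷ [])
          l , l∉ = fresh (ℕ.s≤s (ℕ.s≤s (ℕ.s≤s ℕ.z≤n))) (i ∷ j ∷ [])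
          j≢l = λ j≡l → l∉ (there (here (sym j≡l)))
      in <⇒≱ (<-respʳ-≡ (∈W-ext ω∈W f≗i) 0<ωf)
           (isolated-projection≤0 ω∈W (collapse j (punchOut j≢l)) (≡0 _) i
             (isolates (j∉ ∘ here) j≢l (l∉ ∘ here)))
      where
      isolates : ∀ {i j l : Fin (3 ℕ.+ m)} → ¬ (j ≡ i) → (j≢l : ¬ (j ≡ l)) → ¬ (l ≡ i) →
                 ∀ t → collapse j (punchOut j≢l) t ≡ collapse j (punchOut j≢l) i → t ≡ i
      isolates {i} {j} j≢i j≢l l≢i t e with j Fin.≟ t | j Fin.≟ i
      ... | _        | yes j≡i  = contradiction j≡i j≢i
      ... | yes refl | no  j≢i′ = contradiction (punchOut-injective j≢l j≢i′ e) l≢i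
      ... | no j≢t   | no  j≢i′ = punchOut-injective j≢t j≢i′ e

  -- Every non-projection in the support is a semiprojection by Świerczkowski's lemma. The case
  -- distinction serves to remove projections: a non-zero minor isolates `f`, and vanishing minors
  -- exclude them.
  semiprojection-case :
    ∀ {m} {ω : Weight D (4 ℕ.+ m)} → ω ∈W → IsPositive ω →
    (∀ (π : Fin (4 ℕ.+ m) → Fin (3 ℕ.+ m)) → OnProjections (ω ⟪ proj ∘ π ⟫)) →
    Dec (∃ λ (π : Fin (4 ℕ.+ m) → Fin (3 ℕ.+ m)) → ∃ λ g → ¬ ((ω ⟪ proj ∘ π ⟫) g ≡ 0ℚ)) → Conclusion
  semiprojection-case {m} {ω} ω∈W (f , ¬proj , 0<ωf) onProj = λ where
      (yes (π , nonzero)) →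
        let ω′ , ω′∈W , f∈supp , only-f = singleton-support
              (combination-⟪⟫ (∈W⇒combination ω∈W) (proj-∈C ∘ π)) (onProj π) nonzero (supp⇒∈C ω∈W 0<ωf) ¬proj
        in _ , ω′ , ω′∈W , (f , f∈supp) , semiprojection 3≤ λ g g∈supp →
             IsSemiprojection-resp (sym ∘ only-f g g∈supp) (semi f 0<ωf ¬proj)
      (no ∄) → _ , ω , ω∈W , (f , 0<ωf) , semiprojection 3≤ λ g 0<ωg → semi g 0<ωg
        (zero-minors⇒¬projection ω∈W
          (λ π h → decidable-stable ((ω ⟪ proj ∘ π ⟫) h ≟ℚ 0ℚ) λ ≢0 → ∄ (π , h , ≢0)) g 0<ωg)
    where
    3≤ : 3 ℕ.≤ 4 ℕ.+ m
    3≤ = ℕ.s≤s (ℕ.s≤s (ℕ.s≤s ℕ.z≤n))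
    semi : ∀ g → g ∈supp ω → ¬ IsProjection g → IsSemiprojection g
    semi g 0<ωg = semiprojection-from-minors g
      (hasMinors g λ π → minor-projection ω∈W π (onProj π) g (0<⇒≢0 0<ωg))

  -- Ternary weightings supported on a single operation.

  module _ {ρ : Weight D m} (R : Combination ρ) (onProj : OnProjections ρ)
           (nonzero : ∃ λ g → ¬ (ρ g ≡ 0ℚ)) where

    good-singleton : ∀ f → f ∈C → Good f → Conclusion
    good-singleton f f∈C good =
      let ω , ω∈W , f∈supp , only-f =
            singleton-support R onProj nonzero f∈C (Good⇒¬projection x₀≢x₁ {f} good)
      in 3 , ω , ω∈W , (f , f∈supp) , listed good only-f
      where
      listed : ∀ {ω} → Good f → (∀ g → g ∈supp ω → g ≗ f) → HasListedSupport D↔Fin ω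
      listed (inj₁ maj) only-f = majority λ g 0<g → IsMajority-resp {f} {g} (sym ∘ only-f g 0<g) maj
      listed (inj₂ min) only-f = minority λ g 0<g → IsMinority-resp {f} {g} (sym ∘ only-f g 0<g) min

    -- If f is x at (x,x,y) for one position only, then f becomes a majority
    -- operation when f itself is substituted for one of its variables.
    typed-singleton : ∀ f → f ∈C → ¬ IsProjection f → Typed f → Conclusion
    typed-singleton f f∈C ¬proj (s , f-type) = by-type s f-type
      where
      semi : ∀ i → HasType f (projType i) → Conclusion
      semi i h =
        let ω , ω∈W , f∈supp , only-f = singleton-support R onProj nonzero f∈C ¬proj
        in 3 , ω , ω∈W , (f , f∈supp) , semiprojection (ℕ.s≤s (ℕ.s≤s (ℕ.s≤s ℕ.z≤n))) λ g 0<g →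
             IsSemiprojection-resp (sym ∘ only-f g 0<g) (projType⇒semiprojection _≟_ {f} i h ¬proj)
      substituted : (gs : Fin 3 → Op D 3) → (∀ i → gs i ∈C) → IsMajority (f ⟦ gs ⟧) → Conclusion
      substituted gs gs∈C maj = good-singleton (f ⟦ gs ⟧) (superpose-∈C f∈C gs∈C) (inj₁ maj)
      gs₀ gs₁ gs₂ : Fin 3 → Op D 3
      gs₀ = λ { zero → f ; (suc i) → proj (suc i) }
      gs₁ = λ { (suc zero) → f ; i → proj i }
      gs₂ = λ { (suc (suc zero)) → f ; i → proj i }
      by-type : ∀ s → HasType f s → Conclusion
      by-type (true  ∷ true  ∷ true  ∷ []) h = good-singleton f f∈C (inj₁ h)
      by-type (false ∷ false ∷ false ∷ []) h = good-singleton f f∈C (inj₂ h)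
      by-type (true  ∷ true  ∷ false ∷ []) h = semi zero h
      by-type (true  ∷ false ∷ true  ∷ []) h = semi (suc zero) h
      by-type (false ∷ true  ∷ true  ∷ []) h = semi (suc (suc zero)) h
      by-type s@(false ∷ false ∷ true  ∷ []) h = substituted gs₀
        (λ { zero → f∈C ; (suc i) → proj-∈C (suc i) })
        (HasType-⟦⟧ {f} {gs₀} s s (projType (suc zero)) (projType (suc (suc zero)))
          h h (HasType-proj (suc zero)) (HasType-proj (suc (suc zero))))
      by-type s@(false ∷ true  ∷ false ∷ []) h = substituted gs₁
        (λ { zero → proj-∈C zero ; (suc zero) → f∈C ; (suc (suc zero)) → proj-∈C (suc (suc zero)) })
        (HasType-⟦⟧ {f} {gs₁} s (projType zero) s (projType (suc (suc zero)))
          h (HasType-proj zero) h (HasType-proj (suc (suc zero))))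
      by-type s@(true  ∷ false ∷ false ∷ []) h = substituted gs₂
        (λ { zero → proj-∈C zero ; (suc zero) → proj-∈C (suc zero) ; (suc (suc zero)) → f∈C })
        (HasType-⟦⟧ {f} {gs₂} s (projType zero) (projType (suc zero)) s
          h (HasType-proj zero) (HasType-proj (suc zero)) h)

  -- Ternary weightings with vanishing minors and no majority operation.

  private
    -- The identifications producing (x,x,y), (x,y,x) and (y,x,x), in the order of the entries of a
    -- type.
    pattern₃ : Fin 3 → Fin 3 → Fin 2
    pattern₃ zero             = lookup (zero ∷ zero ∷ suc zero ∷ [])
    pattern₃ (suc zero)       = lookup (zero ∷ suc zero ∷ zero ∷ [])
    pattern₃ (suc (suc zero)) = lookup (suc zero ∷ zero ∷ zero ∷ [])

    second? : ∀ i (f : Op D 3) → Dec (f ⟦ proj ∘ pattern₃ i ⟧ ≗ proj (suc zero))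
    second? i f = (f ⟦ proj ∘ pattern₃ i ⟧) ≗? proj (suc zero)

    second-cong : ∀ i (f g : Op D 3) → f ≗ g → f ⟦ proj ∘ pattern₃ i ⟧ ≗ proj (suc zero) →
                  g ⟦ proj ∘ pattern₃ i ⟧ ≗ proj (suc zero)
    second-cong i f g f≗g e xs = trans (sym (f≗g _)) (e xs)

    pattern₃-HasType : ∀ f s → HasType f s → ∀ i x y →
      (f ⟦ proj ∘ pattern₃ i ⟧) (x ∷ y ∷ []) ≡ (if lookup s i then x else y)
    pattern₃-HasType f (p ∷ q ∷ r ∷ []) h zero             x y = proj₁ (h x y)
    pattern₃-HasType f (p ∷ q ∷ r ∷ []) h (suc zero)       x y = proj₁ (proj₂ (h x y))
    pattern₃-HasType f (p ∷ q ∷ r ∷ []) h (suc (suc zero)) x y = proj₂ (proj₂ (h x y))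

    false⇒second : ∀ f s → HasType f s → ∀ i → lookup s i ≡ false →
                   f ⟦ proj ∘ pattern₃ i ⟧ ≗ proj (suc zero)
    false⇒second f s h i sᵢ (x ∷ y ∷ []) =
      trans (pattern₃-HasType f s h i x y) (cong (if_then x else y) sᵢ)

    true⇒first : ∀ f s → HasType f s → ∀ i → lookup s i ≡ true →
                 f ⟦ proj ∘ pattern₃ i ⟧ ≗ proj zero
    true⇒first f s h i sᵢ (x ∷ y ∷ []) =
      trans (pattern₃-HasType f s h i x y) (cong (if_then x else y) sᵢ)

    true⇒¬second : ∀ f s → HasType f s → ∀ i → lookup s i ≡ true →
                   ¬ (f ⟦ proj ∘ pattern₃ i ⟧ ≗ proj (suc zero))
    true⇒¬second f s h i sᵢ e =
      x₀≢x₁ (trans (sym (true⇒first f s h i sᵢ (x₀ ∷ x₁ ∷ []))) (e (x₀ ∷ x₁ ∷ [])))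

    opaque
      seconds : Fin 3 → Weight D 3
      seconds i f = [ second? i f ] 1ℚ

      seconds-ext : ∀ i → Extensional (seconds i)
      seconds-ext i {f} {g} f≗g =
        []-cong (second? i f) (second? i g) (second-cong i f g f≗g) (second-cong i g f (sym ∘ f≗g)) 1ℚ

      []-seconds : ∀ i f x → [ second? i f ] x ≡ x * seconds i f
      []-seconds i f x = []-one (second? i f) x

    falseCount : Bool → ℚ
    falseCount b = if b then 0ℚ else 1ℚ

    opaque
      unfolding seconds

      seconds-type : ∀ f s → HasType f s → ∀ i → seconds i f ≡ falseCount (lookup s i)
      seconds-type f s h i = by (lookup s i) refl
        where
        by : ∀ b → lookup s i ≡ b → seconds i f ≡ falseCount b
        by true  sᵢ = []-no (second? i f) (true⇒¬second f s h i sᵢ) 1ℚ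
        by false sᵢ = []-yes (second? i f) (false⇒second f s h i sᵢ) 1ℚ

    ∑-seconds : ∀ ω i → ∑ (λ f → ω f * seconds i f) ≡ (ω ⟪ proj ∘ pattern₃ i ⟫) (proj (suc zero))
    ∑-seconds ω i = trans (∑-cong λ f → sym ([]-seconds i f (ω f)))
                          (sym (⟪⟫≡∑ {gs = proj ∘ pattern₃ i} ω (proj (suc zero))))

    -- The number of entries false in a type, minus one: negative for
    -- majority operations, zero for the types of projections, else positive.
    excessType : Type₃ → ℚ
    excessType (p ∷ q ∷ r ∷ []) = falseCount p + (falseCount q + (falseCount r + - 1ℚ))

    excess : Weight D 3
    excess f = seconds zero f + (seconds (suc zero) f + (seconds (suc (suc zero)) f + - 1ℚ))

    excess-ext : Extensional excess
    excess-ext f≗g = cong₂ _+_ (seconds-ext zero f≗g)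
      (cong₂ _+_ (seconds-ext (suc zero) f≗g) (cong (_+ - 1ℚ) (seconds-ext (suc (suc zero)) f≗g)))

    excess-type : ∀ f s → HasType f s → excess f ≡ excessType s
    excess-type f s@(p ∷ q ∷ r ∷ []) h = cong₂ _+_ (seconds-type f s h zero)
      (cong₂ _+_ (seconds-type f s h (suc zero)) (cong (_+ - 1ℚ) (seconds-type f s h (suc (suc zero)))))

    excessType-projType : ∀ i → excessType (projType i) ≡ 0ℚ
    excessType-projType zero             = refl
    excessType-projType (suc zero)       = refl
    excessType-projType (suc (suc zero)) = refl

    excess-cases : ∀ s → s ≡ true ∷ true ∷ true ∷ [] ⊎ (∃ λ i → s ≡ projType i) ⊎ 0ℚ < excessType s
    excess-cases (true  ∷ true  ∷ true  ∷ []) = inj₁ refl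
    excess-cases (true  ∷ true  ∷ false ∷ []) = inj₂ (inj₁ (zero , refl))
    excess-cases (true  ∷ false ∷ true  ∷ []) = inj₂ (inj₁ (suc zero , refl))
    excess-cases (false ∷ true  ∷ true  ∷ []) = inj₂ (inj₁ (suc (suc zero) , refl))
    excess-cases (true  ∷ false ∷ false ∷ []) = inj₂ (inj₂ (from-yes (0ℚ <? 1ℚ)))
    excess-cases (false ∷ true  ∷ false ∷ []) = inj₂ (inj₂ (from-yes (0ℚ <? 1ℚ)))
    excess-cases (false ∷ false ∷ true  ∷ []) = inj₂ (inj₂ (from-yes (0ℚ <? 1ℚ)))
    excess-cases (false ∷ false ∷ false ∷ []) = inj₂ (inj₂ (from-yes (0ℚ <? (1ℚ + 1ℚ))))

    *-≡0ˡ : ∀ {x} y → x ≡ 0ℚ → x * y ≡ 0ℚ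
    *-≡0ˡ y refl = *-zeroˡ y

    *-≡0ʳ : ∀ x {y} → y ≡ 0ℚ → x * y ≡ 0ℚ
    *-≡0ʳ x refl = *-zeroʳ x

  module _ {ω : Weight D 3} (ω∈W : ω ∈W) (ω-typed : ∀ f → ¬ (ω f ≡ 0ℚ) → Typed f) where

    -- Vanishing minors make the ω-weighted sum of the excess vanish.
    no-majority⇒semiprojections :
      (∀ (π : Fin 3 → Fin 2) g → (ω ⟪ proj ∘ π ⟫) g ≡ 0ℚ) → (∀ f → IsMajority f → ¬ (f ∈supp ω)) →
      ∀ f → f ∈supp ω → IsSemiprojection f
    no-majority⇒semiprojections minors≡0 ∄majority f 0<ωf =
      let s , h = ω-typed f (0<⇒≢0 0<ωf) in by-case s h (excess-cases s)
      where
      ∑≡0 : ∑ (λ g → ω g * excess g) ≡ 0ℚ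
      ∑≡0 = begin
        ∑ (λ g → ω g * excess g)
          ≡⟨ ∑-cong (λ g → distrib (ω g) (seconds zero g) (seconds (suc zero) g) (seconds (suc (suc zero)) g)) ⟩
        ∑ (λ g → ω g * seconds zero g +
                 (ω g * seconds (suc zero) g + (ω g * seconds (suc (suc zero)) g + ω g * - 1ℚ)))
          ≡⟨ trans (∑-+ (x zero) (λ g → x (suc zero) g + (x (suc (suc zero)) g + ω g * - 1ℚ)))
               (cong (∑ (x zero) +_) (trans (∑-+ (x (suc zero)) (λ g → x (suc (suc zero)) g + ω g * - 1ℚ))
                 (cong (∑ (x (suc zero)) +_) (∑-+ (x (suc (suc zero))) (λ g → ω g * - 1ℚ))))) ⟩
        ∑ (λ g → ω g * seconds zero g) + (∑ (λ g → ω g * seconds (suc zero) g) +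
          (∑ (λ g → ω g * seconds (suc (suc zero)) g) + ∑ (λ g → ω g * - 1ℚ)))
          -- The first three sums are values of minors at the second projection. The last one is -1
          -- times the total weight.
          ≡⟨ cong₂ _+_ (minor≡0 zero) (cong₂ _+_ (minor≡0 (suc zero)) (cong₂ _+_ (minor≡0 (suc (suc zero)))
               (trans (∑-*ʳ (- 1ℚ) ω) (*-≡0ˡ (- 1ℚ) (∈W-sum ω∈W))))) ⟩
        0ℚ ∎
        where
        open ≡-Reasoning
        x : Fin 3 → Weight D 3
        x i g = ω g * seconds i g
        distrib : ∀ x y₁ y₂ y₃ → x * (y₁ + (y₂ + (y₃ + - 1ℚ))) ≡ x * y₁ + (x * y₂ + (x * y₃ + x * - 1ℚ))
        distrib x y₁ y₂ y₃ = trans (*-distribˡ-+ x y₁ _) (cong (x * y₁ +_)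
          (trans (*-distribˡ-+ x y₂ _) (cong (x * y₂ +_) (*-distribˡ-+ x y₃ (- 1ℚ)))))
        minor≡0 : ∀ i → ∑ (λ g → ω g * seconds i g) ≡ 0ℚ
        minor≡0 i = trans (∑-seconds ω i) (minors≡0 (pattern₃ i) (proj (suc zero)))
      0≤summand : ∀ g → 0ℚ ≤ ω g * excess g
      0≤summand g = decide (ω g <? 0ℚ) (ω g ≟ℚ 0ℚ)
        where
        by-type : 0ℚ < ω g → ∀ s → HasType g s →
                  s ≡ true ∷ true ∷ true ∷ [] ⊎ (∃ λ i → s ≡ projType i) ⊎ 0ℚ < excessType s → 0ℚ ≤ ω g * excess g
        by-type 0<ωg s h (inj₁ refl) = contradiction 0<ωg (∄majority g h)
        by-type 0<ωg s h (inj₂ (inj₁ (i , refl))) =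
          ≤-reflexive (sym (*-≡0ʳ (ω g) (trans (excess-type g s h) (excessType-projType i))))
        by-type 0<ωg s h (inj₂ (inj₂ 0<)) =
          0≤* (<⇒≤ 0<ωg) (<⇒≤ (<-respʳ-≡ (sym (excess-type g s h)) 0<))
        decide : Dec (ω g < 0ℚ) → Dec (ω g ≡ 0ℚ) → 0ℚ ≤ ω g * excess g
        decide (yes ωg<0) _ =
          let i , g≗i = negative (isWeighting ω∈W) g ωg<0
              h = HasType-resp {proj i} {g} (sym ∘ g≗i) (projType i) (HasType-proj i)
          in ≤-reflexive (sym (*-≡0ʳ (ω g) (trans (excess-type g (projType i) h) (excessType-projType i))))
        decide (no _) (yes ωg≡0) = ≤-reflexive (sym (*-≡0ˡ (excess g) ωg≡0))
        decide (no ωg≮0) (no ωg≢0) = let s , h = ω-typed g ωg≢0 in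
          by-type (≤∧≢⇒< (≮⇒≥ ωg≮0) (ωg≢0 ∘ sym)) s h (excess-cases s)
      by-case : ∀ s → HasType f s →
                s ≡ true ∷ true ∷ true ∷ [] ⊎ (∃ λ i → s ≡ projType i) ⊎ 0ℚ < excessType s → IsSemiprojection f
      by-case s h (inj₁ refl) = contradiction 0<ωf (∄majority f h)
      by-case s h (inj₂ (inj₁ (i , refl))) =
        projType⇒semiprojection _≟_ {f} i h (zero-minors⇒¬projection ω∈W minors≡0 f 0<ωf)
      -- All summands are non-negative, so a positive one at `f` would make the vanishing sum
      -- positive.
      by-case s h (inj₂ (inj₂ 0<)) = contradiction ∑≡0
        (0<⇒≢0 (∑-pos (λ e → cong₂ _*_ (∈W-ext ω∈W e) (excess-ext e)) 0≤summand f
          (0<* 0<ωf (<-respʳ-≡ (sym (excess-type f s h)) 0<))))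

  -- The proportion 2 : 1 of majority and minority operations.

  -- With ρ scaled to the value -1 on the projections, the operations that
  -- are y at (x,x,y) are the minorities and e₃; so that minor vanishes
  -- exactly if the minorities have total weight 1.
  module _ {ρ : Weight D 3} (R : Rule (proj zero) (List.tabulate op) ρ) where

    open Rule R

    private
      first : Op D 3
      first = proj zero

      0<-ρ₀ : 0ℚ < - ρ first
      0<-ρ₀ = neg-antimono-< ρb<0

      instance
        ρ₀≢0 : NonZero (- ρ first)
        ρ₀≢0 = ≢-nonZero (0<⇒≢0 0<-ρ₀)

      scale : ℚ
      scale = 1/ (- ρ first)

      0<scale : 0ℚ < scale
      0<scale = positive⁻¹ scale ⦃ 1/pos⇒pos (- ρ first) ⦃ positive 0<-ρ₀ ⦄ ⦄

      σ : Weight D 3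
      σ f = scale * ρ f

      σ-combination : Combination σ
      σ-combination = combination-* combination (<⇒≤ 0<scale)

      -- The rotations of the first projection are the three projections, so the negative weight of
      -- its rule lies exactly on them, in equal parts.
      orbit⇒projection : ∀ f → Orbit first f → IsProjection f
      orbit⇒projection f (zero             , e) = zero , e
      orbit⇒projection f (suc zero         , e) = suc zero , λ { xs@(_ ∷ _ ∷ _ ∷ []) → e xs }
      orbit⇒projection f (suc (suc zero)   , e) = suc (suc zero) , λ { xs@(_ ∷ _ ∷ _ ∷ []) → e xs }

      projection-orbit : ∀ i → Orbit first (proj i)
      projection-orbit zero             = zero , λ _ → refl
      projection-orbit (suc zero)       = suc zero , λ { (_ ∷ _ ∷ _ ∷ []) → refl }
      projection-orbit (suc (suc zero)) = suc (suc zero) , λ { (_ ∷ _ ∷ _ ∷ []) → refl }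

      σ-proj : ∀ i → σ (proj i) ≡ - 1ℚ
      σ-proj i = begin
        scale * ρ (proj i)     ≡⟨ cong (scale *_) (orbit-inv (projection-orbit i)) ⟩
        scale * ρ first        ≡⟨ cong (scale *_) (⁻¹-involutive (ρ first)) ⟨
        scale * - (- ρ first)  ≡⟨ neg-distribʳ-* scale (- ρ first) ⟨
        - (scale * - ρ first)  ≡⟨ cong -_ (*-inverseˡ (- ρ first)) ⟩
        - 1ℚ                   ∎
        where open ≡-Reasoning

    data Kind (f : Op D 3) : Set a where
      weightless  : σ f ≡ 0ℚ → Kind f
      majority    : 0ℚ < σ f → IsMajority f → Kind f
      minority    : 0ℚ < σ f → IsMinority f → Kind f
      projection  : ∀ i → f ≗ proj i → Kind f

    private
      -- After elimination no bad operation off the orbit of the first projection retains weight.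
      kind : ∀ f → Kind f
      kind f = decide (good? f) (orbit? first f) (ρ f ≟ℚ 0ℚ)
        where
        good-kind : 0ℚ < σ f → Good f → Kind f
        good-kind 0<σf (inj₁ maj) = majority 0<σf maj
        good-kind 0<σf (inj₂ min) = minority 0<σf min
        decide : Dec (Good f) → Dec (Orbit first f) → Dec (ρ f ≡ 0ℚ) → Kind f
        decide _          _         (yes ρf≡0) = weightless (*-≡0ʳ scale ρf≡0)
        decide _          (yes f∈o) (no _)     = let i , e = orbit⇒projection f f∈o in projection i e
        decide (yes good) (no f∉o)  (no ρf≢0)  =
          good-kind (0<* 0<scale (≤∧≢⇒< (off-orbit f f∉o) (ρf≢0 ∘ sym))) good
        decide (no bad)   (no f∉o)  (no ρf≢0)  = contradiction (eliminated-all R f bad f∉o) ρf≢0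

      σ∈W : σ ∈W
      σ∈W = combination-∈W σ-combination λ f σf<0 → negative-kind f σf<0 (kind f)
        where
        negative-kind : ∀ f → σ f < 0ℚ → Kind f → IsProjection f
        negative-kind f σf<0 (weightless σf≡0) = contradiction σf≡0 (<⇒≢ σf<0)
        negative-kind f σf<0 (majority 0<σf _) = contradiction σf<0 (<-asym 0<σf)
        negative-kind f σf<0 (minority 0<σf _) = contradiction σf<0 (<-asym 0<σf)
        negative-kind f σf<0 (projection i e)  = i , e

      σ-projection : ∀ {f i} → f ≗ proj i → σ f ≡ - 1ℚ
      σ-projection {i = i} e = trans (combination-ext σ-combination e) (σ-proj i)

      supp-good : ∀ f → f ∈supp σ → Good f
      supp-good f 0<σf = by-kind (kind f)
        where
        by-kind : Kind f → Good f
        by-kind (weightless σf≡0) = contradiction σf≡0 (0<⇒≢0 0<σf)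
        by-kind (majority _ maj)  = inj₁ maj
        by-kind (minority _ min)  = inj₂ min
        by-kind (projection i e)  =
          contradiction (<-respʳ-≡ (σ-projection e) 0<σf) (from-no (0ℚ <? - 1ℚ))

      supported : ∃ λ f → f ∈supp σ
      supported = ∃>0 (combination-ext σ-combination) (combination-sum σ-combination) first
        λ σ≡0 → contradiction (trans (sym (σ-proj zero)) σ≡0) λ ()

      majority? : ∀ f → Dec (f ∈supp σ × IsMajority f)
      majority? f = (0ℚ <? σ f) ×-dec isMajority? f

      minority? : ∀ f → Dec (f ∈supp σ × IsMinority f)
      minority? f = (0ℚ <? σ f) ×-dec isMinority? f

      []-zero : ∀ {P : Set p} (d : Dec P) {x} → x ≡ 0ℚ → [ d ] x ≡ 0ℚ
      []-zero (yes _) x≡0 = x≡0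
      []-zero (no _)  _   = refl

      projection≢ : {f : Op D 3} {i j : Fin 3} → f ≗ proj i → ¬ (j ≡ i) → ¬ (proj j ≗ f)
      projection≢ f≗i j≢i j≗f = j≢i (proj-injective λ xs → trans (j≗f xs) (f≗i xs))

      good≢projection : ∀ {f} → Good f → ∀ j → ¬ (proj j ≗ f)
      good≢projection {f} good j j≗f = Good⇒¬projection x₀≢x₁ {f} good (j , sym ∘ j≗f)

      projection≢majority : ∀ {f i} {P : Set p} → f ≗ proj i → ¬ (P × IsMajority f)
      projection≢majority {f = f} {i} f≗i (_ , maj) = Good⇒¬projection x₀≢x₁ {f} (inj₁ maj) (i , f≗i)

      projection≢minority : ∀ {f i} {P : Set p} → f ≗ proj i → ¬ (P × IsMinority f)
      projection≢minority {f = f} {i} f≗i (_ , min) = Good⇒¬projection x₀≢x₁ {f} (inj₂ min) (i , f≗i)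

      minor-summand : ∀ f → [ second? zero f ] σ f ≡ [ minority? f ] σ f + [ proj (suc (suc zero)) ≗? f ] σ f
      minor-summand f = by-kind (kind f)
        where
        e₃ : Op D 3
        e₃ = proj (suc (suc zero))
        assemble : ∀ {x y z} → [ second? zero f ] σ f ≡ x → [ minority? f ] σ f ≡ y → [ e₃ ≗? f ] σ f ≡ z →
                  x ≡ y + z → [ second? zero f ] σ f ≡ [ minority? f ] σ f + [ e₃ ≗? f ] σ f
        assemble e e′ e″ x≡y+z = trans e (trans x≡y+z (sym (cong₂ _+_ e′ e″)))
        typeOf : ∀ {i} → f ≗ proj i → HasType f (projType i)
        typeOf {i} e = HasType-resp {proj i} {f} (sym ∘ e) (projType i) (HasType-proj i)
        by-kind : Kind f → [ second? zero f ] σ f ≡ [ minority? f ] σ f + [ e₃ ≗? f ] σ f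
        by-kind (weightless σf≡0) =
          assemble ([]-zero (second? zero f) σf≡0) ([]-zero (minority? f) σf≡0) ([]-zero (e₃ ≗? f) σf≡0) refl
        by-kind (majority _ maj) = assemble
          ([]-no (second? zero f) (true⇒¬second f (true ∷ true ∷ true ∷ []) maj zero refl) (σ f))
          ([]-no (minority? f) (λ (_ , min) → majority∧minority x₀≢x₁ {f} maj min) (σ f))
          ([]-no (e₃ ≗? f) (good≢projection {f} (inj₁ maj) _) (σ f)) refl
        by-kind (minority 0<σf min) = assemble
          ([]-yes (second? zero f) (false⇒second f (false ∷ false ∷ false ∷ []) min zero refl) (σ f))
          ([]-yes (minority? f) (0<σf , min) (σ f))
          ([]-no (e₃ ≗? f) (good≢projection {f} (inj₂ min) _) (σ f)) (sym (+-identityʳ (σ f)))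
        by-kind (projection zero e) = assemble
          ([]-no (second? zero f) (true⇒¬second f (projType zero) (typeOf e) zero refl) (σ f))
          ([]-no (minority? f) (projection≢minority {f = f} e) (σ f))
          ([]-no (e₃ ≗? f) (projection≢ e λ ()) (σ f)) refl
        by-kind (projection (suc zero) e) = assemble
          ([]-no (second? zero f) (true⇒¬second f (projType (suc zero)) (typeOf e) zero refl) (σ f))
          ([]-no (minority? f) (projection≢minority {f = f} e) (σ f))
          ([]-no (e₃ ≗? f) (projection≢ e λ ()) (σ f)) refl
        by-kind (projection (suc (suc zero)) e) = assemble
          ([]-yes (second? zero f) (false⇒second f (projType (suc (suc zero))) (typeOf e) zero refl) (σ f))
          ([]-no (minority? f) (projection≢minority {f = f} e) (σ f))
          ([]-yes (e₃ ≗? f) (sym ∘ e) (σ f)) (sym (+-identityˡ (σ f)))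

      only : Fin 3 → Weight D 3
      only i f = [ proj i ≗? f ] σ f

      -- Summed over all operations, this turns the zero total into majority weight plus minority
      -- weight minus 3.
      total-summand : ∀ f → σ f ≡ [ majority? f ] σ f + ([ minority? f ] σ f +
                        (only zero f + (only (suc zero) f + only (suc (suc zero)) f)))
      total-summand f = by-kind (kind f)
        where
        assemble : ∀ {x y z u v} → [ majority? f ] σ f ≡ x → [ minority? f ] σ f ≡ y →
                  only zero f ≡ z → only (suc zero) f ≡ u → only (suc (suc zero)) f ≡ v →
                  σ f ≡ x + (y + (z + (u + v))) →
                  σ f ≡ [ majority? f ] σ f + ([ minority? f ] σ f +
                        (only zero f + (only (suc zero) f + only (suc (suc zero)) f)))
        assemble refl refl refl refl refl e = e
        by-kind : Kind f → σ f ≡ [ majority? f ] σ f + ([ minority? f ] σ f +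
                           (only zero f + (only (suc zero) f + only (suc (suc zero)) f)))
        by-kind (weightless σf≡0) = assemble
          ([]-zero (majority? f) σf≡0) ([]-zero (minority? f) σf≡0)
          ([]-zero (proj zero ≗? f) σf≡0) ([]-zero (proj (suc zero) ≗? f) σf≡0)
          ([]-zero (proj (suc (suc zero)) ≗? f) σf≡0) σf≡0
        by-kind (majority 0<σf maj) = assemble
          ([]-yes (majority? f) (0<σf , maj) (σ f))
          ([]-no (minority? f) (λ (_ , min) → majority∧minority x₀≢x₁ {f} maj min) (σ f))
          ([]-no (proj zero ≗? f) (good≢projection {f} (inj₁ maj) _) (σ f))
          ([]-no (proj (suc zero) ≗? f) (good≢projection {f} (inj₁ maj) _) (σ f))
          ([]-no (proj (suc (suc zero)) ≗? f) (good≢projection {f} (inj₁ maj) _) (σ f))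
          (sym (+-identityʳ (σ f)))
        by-kind (minority 0<σf min) = assemble
          ([]-no (majority? f) (λ (_ , maj) → majority∧minority x₀≢x₁ {f} maj min) (σ f))
          ([]-yes (minority? f) (0<σf , min) (σ f))
          ([]-no (proj zero ≗? f) (good≢projection {f} (inj₂ min) _) (σ f))
          ([]-no (proj (suc zero) ≗? f) (good≢projection {f} (inj₂ min) _) (σ f))
          ([]-no (proj (suc (suc zero)) ≗? f) (good≢projection {f} (inj₂ min) _) (σ f))
          (sym (trans (+-identityˡ _) (+-identityʳ (σ f))))
        by-kind (projection zero e) = assemble
          ([]-no (majority? f) (projection≢majority {f = f} e) (σ f))
          ([]-no (minority? f) (projection≢minority {f = f} e) (σ f))
          ([]-yes (proj zero ≗? f) (sym ∘ e) (σ f))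
          ([]-no (proj (suc zero) ≗? f) (projection≢ e λ ()) (σ f))
          ([]-no (proj (suc (suc zero)) ≗? f) (projection≢ e λ ()) (σ f))
          (sym (trans (+-identityˡ _) (trans (+-identityˡ _) (+-identityʳ (σ f)))))
        by-kind (projection (suc zero) e) = assemble
          ([]-no (majority? f) (projection≢majority {f = f} e) (σ f))
          ([]-no (minority? f) (projection≢minority {f = f} e) (σ f))
          ([]-no (proj zero ≗? f) (projection≢ e λ ()) (σ f))
          ([]-yes (proj (suc zero) ≗? f) (sym ∘ e) (σ f))
          ([]-no (proj (suc (suc zero)) ≗? f) (projection≢ e λ ()) (σ f))
          (sym (trans (+-identityˡ _) (trans (+-identityˡ _) (trans (+-identityˡ _) (+-identityʳ (σ f))))))
        by-kind (projection (suc (suc zero)) e) = assemble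
          ([]-no (majority? f) (projection≢majority {f = f} e) (σ f))
          ([]-no (minority? f) (projection≢minority {f = f} e) (σ f))
          ([]-no (proj zero ≗? f) (projection≢ e λ ()) (σ f))
          ([]-no (proj (suc zero) ≗? f) (projection≢ e λ ()) (σ f))
          ([]-yes (proj (suc (suc zero)) ≗? f) (sym ∘ e) (σ f))
          (sym (trans (+-identityˡ _) (trans (+-identityˡ _) (trans (+-identityˡ _) (+-identityˡ (σ f))))))

      ∑-only : ∀ i → ∑ (only i) ≡ - 1ℚ
      ∑-only i = trans (∑-single (combination-ext σ-combination) (proj i)) (σ-proj i)

      minor : Weight D 2
      minor = σ ⟪ proj ∘ pattern₃ zero ⟫

      minor-onProjections : OnProjections minor
      minor-onProjections g ≢0 =
        let f , e , σf≢0 = ⟪⟫-source≢0 {gs = proj ∘ pattern₃ zero} σ {g} ≢0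
            s , h = typed f λ ρf≡0 → σf≢0 (*-≡0ʳ scale ρf≡0)
            i , e′ = by f s h (lookup s zero) refl
        in i , λ xs → trans (sym (e xs)) (e′ xs)
        where
        by : ∀ f s → HasType f s → ∀ b → lookup s zero ≡ b → IsProjection (f ⟦ proj ∘ pattern₃ zero ⟧)
        by f s h true  s₀ = zero , true⇒first f s h zero s₀
        by f s h false s₀ = suc zero , false⇒second f s h zero s₀

      ∑-minority : minor (proj (suc zero)) ≡ 0ℚ → ∑ (λ f → [ minority? f ] σ f) ≡ 1ℚ
      ∑-minority minor≡0 = inverseˡ-unique _ (- 1ℚ) (begin
        ∑ (λ f → [ minority? f ] σ f) + - 1ℚ
          ≡⟨ cong (∑ (λ f → [ minority? f ] σ f) +_) (∑-only (suc (suc zero))) ⟨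
        ∑ (λ f → [ minority? f ] σ f) + ∑ (only (suc (suc zero)))
          ≡⟨ ∑-+ (λ f → [ minority? f ] σ f) (only (suc (suc zero))) ⟨
        ∑ (λ f → [ minority? f ] σ f + only (suc (suc zero)) f)
          ≡⟨ ∑-cong minor-summand ⟨
        ∑ (λ f → [ second? zero f ] σ f)
          ≡⟨ ⟪⟫≡∑ {gs = proj ∘ pattern₃ zero} σ (proj (suc zero)) ⟨
        minor (proj (suc zero))
          ≡⟨ minor≡0 ⟩
        0ℚ ∎)
        where open ≡-Reasoning

      ∑-majority : ∑ (λ f → [ minority? f ] σ f) ≡ 1ℚ → ∑ (λ f → [ majority? f ] σ f) ≡ ℤ.+ 2 / 1
      -- The constant is -2: minority weight 1 together with three projections of weight -1 each.
      ∑-majority min≡1 = inverseˡ-unique _ (1ℚ + (- 1ℚ + (- 1ℚ + - 1ℚ))) (begin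
        ∑ maj + (1ℚ + (- 1ℚ + (- 1ℚ + - 1ℚ)))
          ≡⟨ cong (∑ maj +_) (cong₂ _+_ min≡1 (cong₂ _+_ (∑-only zero)
               (cong₂ _+_ (∑-only (suc zero)) (∑-only (suc (suc zero)))))) ⟨
        ∑ maj + (∑ min + (∑ (only zero) + (∑ (only (suc zero)) + ∑ (only (suc (suc zero))))))
          ≡⟨ cong (∑ maj +_) (trans (∑-+ min (λ f → only zero f + (only (suc zero) f + only (suc (suc zero)) f)))
               (cong (∑ min +_) (trans (∑-+ (only zero) (λ f → only (suc zero) f + only (suc (suc zero)) f))
                 (cong (∑ (only zero) +_) (∑-+ (only (suc zero)) (only (suc (suc zero)))))))) ⟨
        ∑ maj + ∑ (λ f → min f + (only zero f + (only (suc zero) f + only (suc (suc zero)) f)))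
          ≡⟨ ∑-+ maj (λ f → min f + (only zero f + (only (suc zero) f + only (suc (suc zero)) f))) ⟨
        ∑ (λ f → maj f + (min f + (only zero f + (only (suc zero) f + only (suc (suc zero)) f))))
          ≡⟨ ∑-cong total-summand ⟨
        ∑ σ
          ≡⟨ combination-sum σ-combination ⟩
        0ℚ ∎)
        where
        open ≡-Reasoning
        maj min : Weight D 3
        maj f = [ majority? f ] σ f
        min f = [ minority? f ] σ f

    -- If the minor vanishes at the second projection, the weights are 2 and 1. Otherwise it is a
    -- non-zero combination supported on projections, and one good operation from the support can be
    -- isolated.
    rule⇒conclusion : Conclusion
    rule⇒conclusion = decide (minor (proj (suc zero)) ≟ℚ 0ℚ)
      where
      decide : Dec (minor (proj (suc zero)) ≡ 0ℚ) → Conclusion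
      decide (yes minor≡0) = 3 , σ , σ∈W , supported , majority-minority supp-good
        (trans (sym (∑≡∑Op (λ f → [ majority? f ] σ f))) (∑-majority (∑-minority minor≡0)))
        (trans (sym (∑≡∑Op (λ f → [ minority? f ] σ f))) (∑-minority minor≡0))
      decide (no minor≢0) = let f , 0<σf = supported in
        good-singleton (combination-⟪⟫ σ-combination (proj-∈C ∘ pattern₃ zero)) minor-onProjections
          (proj (suc zero) , minor≢0) f (supp⇒∈C σ∈W 0<σf) (supp-good f 0<σf)

  -- The ternary case and induction on the arity.

  ternary-case :
    {ω : Weight D 3} → ω ∈W → IsPositive ω →
    (∀ (π : Fin 3 → Fin 2) → OnProjections (ω ⟪ proj ∘ π ⟫)) →
    Dec (∃ λ (π : Fin 3 → Fin 2) → ∃ λ g → ¬ ((ω ⟪ proj ∘ π ⟫) g ≡ 0ℚ)) → Conclusion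
  ternary-case {ω} ω∈W (f , ¬proj , 0<ωf) onProj = λ where
      (yes (π , nonzero)) → typed-singleton (combination-⟪⟫ (∈W⇒combination ω∈W) (proj-∈C ∘ π))
        (onProj π) nonzero f (supp⇒∈C ω∈W 0<ωf) ¬proj (ω-typed f (0<⇒≢0 0<ωf))
      (no ∄) → by-majority
        (λ π h → decidable-stable ((ω ⟪ proj ∘ π ⟫) h ≟ℚ 0ℚ) λ ≢0 → ∄ (π , h , ≢0))
        (anyOp? (λ g → isMajority? g ×-dec (0ℚ <? ω g)) λ {g} {h} g≗h (maj , 0<ωg) →
          IsMajority-resp {g} {h} g≗h maj , <-respʳ-≡ (∈W-ext ω∈W g≗h) 0<ωg)
    where
    ω-typed : ∀ g → ¬ (ω g ≡ 0ℚ) → Typed g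
    ω-typed g ωg≢0 = typed-from-minors _≟_ x₀≢x₁ g
      (hasMinors g λ π → minor-projection ω∈W π (onProj π) g ωg≢0)
    by-majority : (∀ (π : Fin 3 → Fin 2) g → (ω ⟪ proj ∘ π ⟫) g ≡ 0ℚ) →
                  Dec (∃ λ g → IsMajority g × 0ℚ < ω g) → Conclusion
    by-majority minors≡0 (no ∄maj) = 3 , ω , ω∈W , (f , 0<ωf) , semiprojection (ℕ.s≤s (ℕ.s≤s (ℕ.s≤s ℕ.z≤n)))
      (no-majority⇒semiprojections ω∈W ω-typed minors≡0 λ g maj 0<ωg → ∄maj (g , maj , 0<ωg))
    -- The first projection is itself bad and has a rule. Once all operations are eliminated, that
    -- rule has weight only on projections and good operations.
    by-majority _ (yes (g , maj , 0<ωg)) = rule⇒conclusion (proj₂ (eliminate-all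
      (initial-rules ω∈W ω-typed {g} (inj₁ maj) 0<ωg) (List.tabulate op) (proj zero) (proj-∈C zero)
      (projType zero , HasType-proj zero) λ good → Good⇒¬projection x₀≢x₁ {proj zero} good (zero , λ _ → refl)))

  minimal-case :
    ∀ m {ω : Weight D (3 ℕ.+ m)} → ω ∈W → IsPositive ω →
    (∀ (π : Fin (3 ℕ.+ m) → Fin (2 ℕ.+ m)) → OnProjections (ω ⟪ proj ∘ π ⟫)) →
    Dec (∃ λ (π : Fin (3 ℕ.+ m) → Fin (2 ℕ.+ m)) → ∃ λ g → ¬ ((ω ⟪ proj ∘ π ⟫) g ≡ 0ℚ)) → Conclusion
  minimal-case zero    = ternary-case
  minimal-case (suc m) = semiprojection-case

  relabel-cong : (ω : Weight D k) {π π′ : Fin k → Fin m} → π ≗ π′ → ω ⟪ proj ∘ π ⟫ ≗ ω ⟪ proj ∘ π′ ⟫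
  relabel-cong ω π≗π′ = ⟪⟫-congʳ ω λ i xs → cong (lookup xs) (π≗π′ i)

  isPositive? : {ω : Weight D k} → Extensional ω → Dec (IsPositive ω)
  isPositive? {ω = ω} ext = anyOp? (λ f → ¬? (isProjection? f) ×-dec (0ℚ <? ω f))
    λ f≗g (¬proj , 0<ωf) → (λ (i , g≗i) → ¬proj (i , λ xs → trans (f≗g xs) (g≗i xs))) ,
                           <-respʳ-≡ (ext f≗g) 0<ωf

  -- Either some minor is still positive, and the smaller arity applies to it, or every non-zero
  -- weight of every minor lies on a projection, since weights of non-projections are never
  -- negative.
  reduce-arity :
    ∀ m → (∀ {ω : Weight D (2 ℕ.+ m)} → ω ∈W → IsPositive ω → Conclusion) →
    {ω : Weight D (3 ℕ.+ m)} → ω ∈W → IsPositive ω → Conclusion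
  reduce-arity m smaller {ω} ω∈W pos
    with anyMap? {P = λ (π : Fin (3 ℕ.+ m) → Fin (2 ℕ.+ m)) → IsPositive (ω ⟪ proj ∘ π ⟫)}
           (λ π → isPositive? (⟪⟫-ext {gs = proj ∘ π} ω))
           (λ π≗π′ (f , ¬proj , 0<) → f , ¬proj , <-respʳ-≡ (relabel-cong ω π≗π′ f) 0<)
  ... | yes (π , pos′) = smaller (relabel-∈W ω∈W π) pos′
  ... | no ∄pos = minimal-case m ω∈W pos onProj
    (anyMap? (λ π → anyOp? (λ g → ¬? ((ω ⟪ proj ∘ π ⟫) g ≟ℚ 0ℚ))
                           λ f≗g ≢0 → ≢0 ∘ trans (⟪⟫-ext {gs = proj ∘ π} ω f≗g))
             λ π≗π′ (g , ≢0) → g , ≢0 ∘ trans (relabel-cong ω π≗π′ g))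
    where
    onProj : ∀ (π : Fin (3 ℕ.+ m) → Fin (2 ℕ.+ m)) → OnProjections (ω ⟪ proj ∘ π ⟫)
    onProj π g ≢0 = decidable-stable (isProjection? g) λ ¬proj →
      ∄pos (π , g , ¬proj , ≤∧≢⇒< (¬projection⇒0≤ (relabel-∈W ω∈W π) g ¬proj) (≢0 ∘ sym))

  positive⇒conclusion : ∀ k {ω : Weight D k} → ω ∈W → IsPositive ω → Conclusion
  positive⇒conclusion zero ω∈W (f , _ , 0<ωf) = contradiction (supp⇒∈C ω∈W 0<ωf) (nullary-empty f)
  positive⇒conclusion (suc zero) ω∈W (f , ¬proj , 0<ωf) =
    contradiction (zero , rigid f (supp⇒∈C ω∈W 0<ωf)) ¬proj
  positive⇒conclusion (suc (suc zero)) ω∈W = binary-case ω∈W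
  positive⇒conclusion (suc (suc (suc m))) = reduce-arity m (positive⇒conclusion (suc (suc m)))

theorem5 : ∀ {a c w : Level} (D : Set a) (n : ℕ) (D↔Fin : D ↔ Fin n) → 2 ℕ.≤ n →
    (W : WeightedClone D↔Fin c w) → let open WeightedClone W in
    IsRigidCore D↔Fin W →
    (∃ λ k → ∃ λ (ω : Weight D k) → ω ∈W × IsPositive ω) →
    ∃ λ k → ∃ λ (ω : Weight D k) →
    ω ∈W × (∃ λ f → f ∈supp ω) × HasListedSupport D↔Fin ω
theorem5 D _ D↔Fin (ℕ.s≤s (ℕ.s≤s _)) W rigid (k , ω , ω∈W , pos) =
  Proof.positive⇒conclusion D↔Fin {from zero} {from (suc zero)} distinct W rigid k ω∈W pos
  where
  open Inverse D↔Fin using (from; strictlyInverseˡ)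
  distinct : ¬ (from zero ≡ from (suc zero))
  distinct e with () ← trans (sym (strictlyInverseˡ zero)) (trans (cong (Inverse.to D↔Fin) e) (strictlyInverseˡ (suc zero)))
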